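{- For $n\ge4$ put $d=\lfloor n/2\rfloor$ and $$x_-(n)=-\frac{D(n,d-1)}{d\,D(n,d)}-\frac{d-1}{d}\sqrt{\left(\frac{D(n,d-1)}{D(n,d)}\right)^2-\frac{2d}{d-1}\cdot\frac{D(n,d-2)}{D(n,d)}}.$$ Then $$x_-(n)\sim-\frac{1}{36\sqrt6}\,n^3\quad\text{as } n\to\infty \text{ through even integers},$$ $$x_-(n)\sim-\frac{1}{108\sqrt{10}}\,n^3\quad\text{as } n\to\infty \text{ through odd integers}.$$
   Context: For an integer $n\ge1$ and an integer $k\ge 0$, $D(n,k)$ denotes the number of partitions of $[n]=\{1,\dots,n\}$ into exactly $k$ blocks, each block consisting of more than one element (so $D(n,0)=0$ for $n\ge1$). The notation $a(n)\sim b(n)$ means $a(n)/b(n)\to1$. -}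

module Defs where

open import Data.Fin.Base using (Fin)
import Data.Fin.Properties as Fin
open import Data.Fin.Subset as Subset using (Subset; Nonempty; Empty; inside; outside; _∩_) renaming (_∈_ to _∈ˢ_)
open import Data.Fin.Subset.Properties using (nonempty?; _∈?_)
open import Data.Integer.Base as ℤ using (ℤ; +_; -[1+_])
import Data.Integer.Properties as ℤ
import Data.Integer.Tactic.RingSolver as ℤ-Solver
open import Data.List.Base using (List; []; _∷_; _++_; map; length; filter)
open import Data.List.Relation.Unary.All as All using (All)
open import Data.List.Relation.Unary.AllPairs as AllPairs using (AllPairs)
open import Data.List.Relation.Unary.Any as Any using (Any)
open import Data.Nat.Base as ℕ using (ℕ; zero; suc; z≤n; s≤s)
import Data.Nat.DivMod as ℕ
import Data.Nat.Properties as ℕ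
open import Data.Nat.Tactic.RingSolver using (solve-∀)
open import Data.Product.Base using (∃; _×_; _,_; proj₁; proj₂)
open import Data.Rational.Base as ℚ using (ℚ; mkℚ; 0ℚ; 1ℚ)
import Data.Rational.Properties as ℚ
open import Data.Rational.Solver using (module +-*-Solver)
import Data.Rational.Unnormalised.Base as ℚᵘ
import Data.Rational.Unnormalised.Properties as ℚᵘ
open import Data.Sum.Base using (inj₁; inj₂)
open import Data.Vec.Base as Vec using (Vec)
open import Relation.Binary.PropositionalEquality using (_≡_; _≢_; refl; sym; trans; cong; cong₂; subst; subst₂)
open import Relation.Nullary using (Dec; yes; no; contradiction)
open import Relation.Nullary.Decidable using (¬?; _×-dec_; from-yes)

subsets : (n : ℕ) → List (Subset n)
subsets zero    = Vec.[] ∷ []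
subsets (suc n) = map (outside Vec.∷_) (subsets n) ++ map (inside Vec.∷_) (subsets n)

sublists : ∀ {A : Set} → List A → List (List A)
sublists []       = [] ∷ []
sublists (x ∷ xs) = sublists xs ++ map (x ∷_) (sublists xs)

-- `subsets n` lists every subset of Fin n exactly once, so its sublists
-- are the sets of subsets of Fin n, each listed exactly once.
families : (n : ℕ) → List (List (Subset n))
families n = sublists (subsets n)

record IsPartition {n : ℕ} (𝓑 : List (Subset n)) : Set where
  constructor mkIsPartition
  field
    nonempty : All Nonempty 𝓑
    disjoint : AllPairs (λ B C → Empty (B ∩ C)) 𝓑
    covering : ∀ (i : Fin n) → Any (i ∈ˢ_) 𝓑

isPartition? : ∀ {n} (𝓑 : List (Subset n)) → Dec (IsPartition 𝓑)
isPartition? 𝓑 with All.all? nonempty? 𝓑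
                  | AllPairs.allPairs? (λ B C → ¬? (nonempty? (B ∩ C))) 𝓑
                  | Fin.all? (λ i → Any.any? (i ∈?_) 𝓑)
... | yes p | yes q | yes r = yes (mkIsPartition p q r)
... | no ¬p | _     | _     = no λ π → ¬p (IsPartition.nonempty π)
... | _     | no ¬q | _     = no λ π → ¬q (IsPartition.disjoint π)
... | _     | _     | no ¬r = no λ π → ¬r (IsPartition.covering π)

IsPartitionWithoutSingletons : (n k : ℕ) → List (Subset n) → Set
IsPartitionWithoutSingletons n k 𝓑 =
  IsPartition 𝓑 × length 𝓑 ≡ k × All (λ B → 1 ℕ.< Subset.∣ B ∣) 𝓑

isPartitionWithoutSingletons? : ∀ n k (𝓑 : List (Subset n)) →
                                Dec (IsPartitionWithoutSingletons n k 𝓑)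
isPartitionWithoutSingletons? n k 𝓑 =
  isPartition? 𝓑 ×-dec length 𝓑 ℕ.≟ k ×-dec All.all? (λ B → 1 ℕ.<? Subset.∣ B ∣) 𝓑

D : ℕ → ℕ → ℕ
D n k = length (filter (isPartitionWithoutSingletons? n k) (families n))

private
  half : ∀ {ε} → 0ℚ ℚ.< ε → 0ℚ ℚ.< ℚ.½ ℚ.* ε
  half {ε} 0<ε = ℚ.positive⁻¹ (ℚ.½ ℚ.* ε)
    {{ℚ.pos*pos⇒pos ℚ.½ ε {{ℚ.positive 0<ε}}}}

  half+half : ∀ ε → ℚ.½ ℚ.* ε ℚ.+ ℚ.½ ℚ.* ε ≡ ε
  half+half ε = trans (sym (ℚ.*-distribʳ-+ ε ℚ.½ ℚ.½)) (ℚ.*-identityˡ ε)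

  ∣p-q∣≡∣q-p∣ : ∀ p q → ℚ.∣ p ℚ.- q ∣ ≡ ℚ.∣ q ℚ.- p ∣
  ∣p-q∣≡∣q-p∣ p q = trans (sym (ℚ.∣-p∣≡∣p∣ (p ℚ.- q))) (cong ℚ.∣_∣
    (solve 2 (λ p q → :- (p :- q) := q :- p) refl p q))
    where open +-*-Solver

  ∣p∣≤∣p-q∣+∣q∣ : ∀ p q → ℚ.∣ p ∣ ℚ.≤ ℚ.∣ p ℚ.- q ∣ ℚ.+ ℚ.∣ q ∣
  ∣p∣≤∣p-q∣+∣q∣ p q = subst (λ r → ℚ.∣ r ∣ ℚ.≤ ℚ.∣ p ℚ.- q ∣ ℚ.+ ℚ.∣ q ∣)
    (solve 2 (λ p q → p :- q :+ q := p) refl p q) (ℚ.∣p+q∣≤∣p∣+∣q∣ (p ℚ.- q) q)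
    where open +-*-Solver

  p≤r+q⇒p-q≤r : ∀ p q r → p ℚ.≤ r ℚ.+ q → p ℚ.- q ℚ.≤ r
  p≤r+q⇒p-q≤r p q r h = subst (p ℚ.- q ℚ.≤_)
    (solve 2 (λ r q → r :+ q :- q := r) refl r q) (ℚ.+-monoˡ-≤ (ℚ.- q) h)
    where open +-*-Solver

  ∣p-q∣-elim : ∀ (P : ℚ → Set) p q → P (p ℚ.- q) → P (q ℚ.- p) → P (ℚ.∣ p ℚ.- q ∣)
  ∣p-q∣-elim P p q a b with ℚ.∣p∣≡p∨∣p∣≡-p (p ℚ.- q)
  ... | inj₁ e = subst P (sym e) a
  ... | inj₂ e = subst P (sym (trans e
        (solve 2 (λ p q → :- (p :- q) := q :- p) refl p q))) b
    where open +-*-Solver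

  ∣∣p∣-∣q∣∣≤∣p-q∣ : ∀ p q → ℚ.∣ ℚ.∣ p ∣ ℚ.- ℚ.∣ q ∣ ∣ ℚ.≤ ℚ.∣ p ℚ.- q ∣
  ∣∣p∣-∣q∣∣≤∣p-q∣ p q = ∣p-q∣-elim (ℚ._≤ ℚ.∣ p ℚ.- q ∣) ℚ.∣ p ∣ ℚ.∣ q ∣
    (p≤r+q⇒p-q≤r ℚ.∣ p ∣ ℚ.∣ q ∣ ℚ.∣ p ℚ.- q ∣ (∣p∣≤∣p-q∣+∣q∣ p q))
    (p≤r+q⇒p-q≤r ℚ.∣ q ∣ ℚ.∣ p ∣ ℚ.∣ p ℚ.- q ∣
      (subst (λ r → ℚ.∣ q ∣ ℚ.≤ r ℚ.+ ℚ.∣ p ∣) (∣p-q∣≡∣q-p∣ q p) (∣p∣≤∣p-q∣+∣q∣ q p)))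

  *-mono-≤-nonNeg : ∀ {p q r s} → 0ℚ ℚ.≤ r → 0ℚ ℚ.≤ q → p ℚ.≤ q → r ℚ.≤ s →
                    p ℚ.* r ℚ.≤ q ℚ.* s
  *-mono-≤-nonNeg {p} {q} {r} {s} 0≤r 0≤q p≤q r≤s = ℚ.≤-trans
    (ℚ.*-monoʳ-≤-nonNeg r {{ℚ.nonNegative 0≤r}} p≤q)
    (ℚ.*-monoˡ-≤-nonNeg q {{ℚ.nonNegative 0≤q}} r≤s)

  *-pos : ∀ {p q} → 0ℚ ℚ.< p → 0ℚ ℚ.< q → 0ℚ ℚ.< p ℚ.* q
  *-pos {p} {q} 0<p 0<q = ℚ.positive⁻¹ (p ℚ.* q)
    {{ℚ.pos*pos⇒pos p {{ℚ.positive 0<p}} q {{ℚ.positive 0<q}}}}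

  *-distribˡ-- : ∀ p q r → p ℚ.* (q ℚ.- r) ≡ p ℚ.* q ℚ.- p ℚ.* r
  *-distribˡ-- p q r = trans (ℚ.*-distribˡ-+ p q (ℚ.- r))
    (cong (p ℚ.* q ℚ.+_) (sym (ℚ.neg-distribʳ-* p r)))

  *-telescope : ∀ a b a′ b′ →
    a ℚ.* (b ℚ.- b′) ℚ.+ b′ ℚ.* (a ℚ.- a′) ≡ a ℚ.* b ℚ.- a′ ℚ.* b′
  *-telescope a b a′ b′ = trans
    (cong₂ ℚ._+_ (*-distribˡ-- a b b′) (trans (*-distribˡ-- b′ a a′)
      (cong₂ ℚ._-_ (ℚ.*-comm b′ a) (ℚ.*-comm b′ a′))))
    (solve 3 (λ u v w → u :- v :+ (v :- w) := u :- w) refl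
      (a ℚ.* b) (a ℚ.* b′) (a′ ℚ.* b′))
    where open +-*-Solver

  *-cancel-inverse : ∀ p {q} r → p ℚ.* q ≡ 1ℚ → p ℚ.* (q ℚ.* r) ≡ r
  *-cancel-inverse p {q} r e = trans (sym (ℚ.*-assoc p q r))
    (trans (cong (ℚ._* r) e) (ℚ.*-identityˡ r))

  reciprocal : ∀ {p} → 0ℚ ℚ.< p → ∃ λ r → 0ℚ ℚ.< r × p ℚ.* r ≡ 1ℚ
  reciprocal {p} 0<p = ℚ.1/ p , ℚ.positive⁻¹ (ℚ.1/ p) {{ℚ.1/pos⇒pos p}} , ℚ.*-inverseʳ p
    where instance
      p⁺ = ℚ.positive 0<p
      p≠ = ℚ.pos⇒nonZero p

  *-close₁ : ∀ {A δ} p q → 0ℚ ℚ.< A → ℚ.∣ p ∣ ℚ.≤ A → ℚ.∣ q ∣ ℚ.< δ →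
             ℚ.∣ p ℚ.* q ∣ ℚ.< A ℚ.* δ
  *-close₁ {A} p q 0<A p≤ q< = ℚ.≤-<-trans
    (ℚ.≤-trans (ℚ.≤-reflexive (ℚ.∣p*q∣≡∣p∣*∣q∣ p q))
      (ℚ.*-monoʳ-≤-nonNeg ℚ.∣ q ∣ {{ℚ.∣-∣-nonNeg q}} p≤))
    (ℚ.*-monoʳ-<-pos A {{ℚ.positive 0<A}} q<)

  *-close : ∀ {A B C⁻¹ ε} a b a′ b′ → 0ℚ ℚ.< A → 0ℚ ℚ.< B → (A ℚ.+ B) ℚ.* C⁻¹ ≡ 1ℚ →
    ℚ.∣ a ∣ ℚ.≤ A → ℚ.∣ b′ ∣ ℚ.≤ B →
    ℚ.∣ a ℚ.- a′ ∣ ℚ.< C⁻¹ ℚ.* ε → ℚ.∣ b ℚ.- b′ ∣ ℚ.< C⁻¹ ℚ.* ε →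
    ℚ.∣ a ℚ.* b ℚ.- a′ ℚ.* b′ ∣ ℚ.< ε
  *-close {A} {B} {C⁻¹} {ε} a b a′ b′ 0<A 0<B CC⁻¹≡1 a≤ b′≤ a-a′< b-b′< = subst₂ ℚ._<_
    (cong ℚ.∣_∣ (*-telescope a b a′ b′))
    (trans (sym (ℚ.*-distribʳ-+ (C⁻¹ ℚ.* ε) A B)) (*-cancel-inverse (A ℚ.+ B) ε CC⁻¹≡1))
    (ℚ.≤-<-trans (ℚ.∣p+q∣≤∣p∣+∣q∣ (a ℚ.* (b ℚ.- b′)) (b′ ℚ.* (a ℚ.- a′)))
      (ℚ.+-mono-< (*-close₁ a (b ℚ.- b′) 0<A a≤ b-b′<) (*-close₁ b′ (a ℚ.- a′) 0<B b′≤ a-a′<)))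

  inverse-difference : ∀ {i j a b} → i ℚ.* a ≡ 1ℚ → j ℚ.* b ≡ 1ℚ →
    i ℚ.- j ≡ i ℚ.* j ℚ.* (b ℚ.- a)
  inverse-difference {i} {j} {a} {b} ia≡1 jb≡1 = sym (trans (*-distribˡ-- (i ℚ.* j) b a)
    (cong₂ ℚ._-_
      (trans (ℚ.*-assoc i j b) (trans (cong (i ℚ.*_) jb≡1) (ℚ.*-identityʳ i)))
      (trans (cong (ℚ._* a) (ℚ.*-comm i j))
        (trans (ℚ.*-assoc j i a) (trans (cong (j ℚ.*_) ia≡1) (ℚ.*-identityʳ j))))))

  /-mono-≤ : ∀ a b m n → a ℕ.* suc n ℕ.≤ b ℕ.* suc m →
             (+ a ℚ./ suc m) ℚ.≤ (+ b ℚ./ suc n)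
  /-mono-≤ a b m n h = ℚ.toℚᵘ-cancel-≤ (ℚᵘ.≤-trans
    (ℚᵘ.≤-reflexive (ℚ.toℚᵘ-fromℚᵘ (ℚᵘ.mkℚᵘ (+ a) m)))
    (ℚᵘ.≤-trans
      (ℚᵘ.*≤* (subst₂ ℤ._≤_ (ℤ.pos-* a (suc n)) (ℤ.pos-* b (suc m)) (ℤ.+≤+ h)))
      (ℚᵘ.≤-reflexive (ℚᵘ.≃-sym (ℚ.toℚᵘ-fromℚᵘ (ℚᵘ.mkℚᵘ (+ b) n))))))

  /-suc : ∀ a n → (+ suc a ℚ./ suc n) ≡ (+ 1 ℚ./ suc n) ℚ.+ (+ a ℚ./ suc n)
  /-suc a n = ℚ.toℚᵘ-injective (ℚᵘ.≃-trans
    (ℚ.toℚᵘ-fromℚᵘ (ℚᵘ.mkℚᵘ (+ suc a) n))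
    (ℚᵘ.≃-trans (ℚᵘ.*≡* (trans
        (cong (+ suc a ℤ.*_) (ℤ.pos-* (suc n) (suc n))) (lemma (+ a) (+ suc n))))
    (ℚᵘ.≃-sym (ℚᵘ.≃-trans
      (ℚ.toℚᵘ-homo-+ (+ 1 ℚ./ suc n) (+ a ℚ./ suc n))
      (ℚᵘ.+-cong (ℚ.toℚᵘ-fromℚᵘ (ℚᵘ.mkℚᵘ (+ 1) n)) (ℚ.toℚᵘ-fromℚᵘ (ℚᵘ.mkℚᵘ (+ a) n)))))))
    where
    lemma : ∀ a N → (+ 1 ℤ.+ a) ℤ.* (N ℤ.* N) ≡ (+ 1 ℤ.* N ℤ.+ a ℤ.* N) ℤ.* N
    lemma = ℤ-Solver.solve-∀

  archimedean : ∀ ε → 0ℚ ℚ.< ε → ∃ λ N → (+ 1 ℚ./ suc N) ℚ.< ε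
  archimedean ε@(mkℚ (+ suc p) d c) _ = suc d , ℚ.toℚᵘ-cancel-< (ℚᵘ.≤-<-trans
    (ℚᵘ.≤-reflexive (ℚ.toℚᵘ-fromℚᵘ (ℚᵘ.mkℚᵘ (+ 1) (suc d))))
    (ℚᵘ.*<* (ℤ.+<+ lemma)))
    where
    lemma : 1 ℕ.* suc d ℕ.< suc p ℕ.* suc (suc d)
    lemma = ℕ.≤-trans (s≤s (ℕ.≤-reflexive (ℕ.*-identityˡ (suc d)))) (ℕ.m≤n*m (suc (suc d)) (suc p))
  archimedean (mkℚ (+ zero)   d c) 0<ε = contradiction (ℚ.positive 0<ε) λ ()
  archimedean (mkℚ (-[1+ _ ]) d c) 0<ε = contradiction (ℚ.positive 0<ε) λ ()

IsCauchy : (ℕ → ℚ) → Set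
IsCauchy s = ∀ ε → 0ℚ ℚ.< ε → ∃ λ N → ∀ m n → N ℕ.≤ m → N ℕ.≤ n →
             ℚ.∣ s m ℚ.- s n ∣ ℚ.< ε

record ℝ : Set where
  constructor mkℝ
  field
    seq    : ℕ → ℚ
    cauchy : IsCauchy seq

open ℝ public

infix 4 _<_
_<_ : ℝ → ℝ → Set
x < y = ∃ λ δ → 0ℚ ℚ.< δ × ∃ λ N → ∀ n → N ℕ.≤ n → seq x n ℚ.+ δ ℚ.≤ seq y n

fromℚ : ℚ → ℝ
seq    (fromℚ q)       = λ _ → q
cauchy (fromℚ q) ε 0<ε = 0 , λ _ _ _ _ →
  subst (ℚ._< ε) (sym (cong ℚ.∣_∣ (ℚ.+-inverseʳ q))) 0<ε

fromℕ : ℕ → ℝ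
fromℕ n = fromℚ (+ n ℚ./ 1)

infix  8 -_
infixl 7 _*_
infixl 6 _+_ _-_

_+_ : ℝ → ℝ → ℝ
seq    (x + y)       = λ n → seq x n ℚ.+ seq y n
cauchy (x + y) ε 0<ε
  with N , X ← cauchy x (ℚ.½ ℚ.* ε) (half 0<ε)
     | M , Y ← cauchy y (ℚ.½ ℚ.* ε) (half 0<ε)
  = N ℕ.⊔ M , λ m n p q →
    let a = seq x m ; b = seq y m ; a′ = seq x n ; b′ = seq y n in
    subst₂ ℚ._<_
      (cong ℚ.∣_∣ (solve 4 (λ a b a′ b′ → a :- a′ :+ (b :- b′) := a :+ b :- (a′ :+ b′))
        refl a b a′ b′))
      (half+half ε)
      (ℚ.≤-<-trans (ℚ.∣p+q∣≤∣p∣+∣q∣ (a ℚ.- a′) (b ℚ.- b′))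
        (ℚ.+-mono-<
          (X m n (ℕ.≤-trans (ℕ.m≤m⊔n N M) p) (ℕ.≤-trans (ℕ.m≤m⊔n N M) q))
          (Y m n (ℕ.≤-trans (ℕ.m≤n⊔m N M) p) (ℕ.≤-trans (ℕ.m≤n⊔m N M) q))))
  where open +-*-Solver

-_ : ℝ → ℝ
seq    (- x)       = λ n → ℚ.- seq x n
cauchy (- x) ε 0<ε with N , X ← cauchy x ε 0<ε = N , λ m n p q →
  subst (ℚ._< ε)
    (trans (∣p-q∣≡∣q-p∣ (seq x m) (seq x n)) (cong ℚ.∣_∣
      (solve 2 (λ a b → b :- a := :- a :- (:- b)) refl (seq x m) (seq x n))))
    (X m n p q)
  where open +-*-Solver

_-_ : ℝ → ℝ → ℝ
x - y = x + - y

∣_∣ : ℝ → ℝ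
seq    ∣ x ∣       = λ n → ℚ.∣ seq x n ∣
cauchy ∣ x ∣ ε 0<ε with N , X ← cauchy x ε 0<ε = N , λ m n p q →
  ℚ.≤-<-trans (∣∣p∣-∣q∣∣≤∣p-q∣ (seq x m) (seq x n)) (X m n p q)

private
  bounded : ∀ x → ∃ λ B → 0ℚ ℚ.< B × ∃ λ N → ∀ n → N ℕ.≤ n → ℚ.∣ seq x n ∣ ℚ.≤ B
  bounded x with N , X ← cauchy x 1ℚ (ℚ.positive⁻¹ 1ℚ) =
    1ℚ ℚ.+ ℚ.∣ seq x N ∣ ,
    ℚ.<-≤-trans (ℚ.positive⁻¹ 1ℚ)
      (ℚ.≤-trans (ℚ.≤-reflexive (sym (ℚ.+-identityʳ 1ℚ)))
        (ℚ.+-monoʳ-≤ 1ℚ (ℚ.0≤∣p∣ (seq x N)))) ,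
    N , λ n p → ℚ.≤-trans (∣p∣≤∣p-q∣+∣q∣ (seq x n) (seq x N))
      (ℚ.+-monoˡ-≤ ℚ.∣ seq x N ∣ (ℚ.<⇒≤ (X n N p ℕ.≤-refl)))

_*_ : ℝ → ℝ → ℝ
seq    (x * y)       = λ n → seq x n ℚ.* seq y n
cauchy (x * y) ε 0<ε = go (bounded x) (bounded y)
  where
  go : (∃ λ A → 0ℚ ℚ.< A × ∃ λ N → ∀ n → N ℕ.≤ n → ℚ.∣ seq x n ∣ ℚ.≤ A) →
       (∃ λ B → 0ℚ ℚ.< B × ∃ λ N → ∀ n → N ℕ.≤ n → ℚ.∣ seq y n ∣ ℚ.≤ B) →
       ∃ λ N → ∀ m n → N ℕ.≤ m → N ℕ.≤ n →
       ℚ.∣ seq x m ℚ.* seq y m ℚ.- seq x n ℚ.* seq y n ∣ ℚ.< ε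
  go (A , 0<A , N₁ , X≤) (B , 0<B , N₂ , Y≤) = N₁ ℕ.⊔ N₂ ℕ.⊔ (N₃ ℕ.⊔ N₄) , λ m n p q →
    *-close (seq x m) (seq y m) (seq x n) (seq y n) 0<A 0<B (proj₂ (proj₂ C))
      (X≤ m (ℕ.≤-trans N₁≤ p)) (Y≤ n (ℕ.≤-trans N₂≤ q))
      (proj₂ X m n (ℕ.≤-trans N₃≤ p) (ℕ.≤-trans N₃≤ q))
      (proj₂ Y m n (ℕ.≤-trans N₄≤ p) (ℕ.≤-trans N₄≤ q))
    where
    C = reciprocal (ℚ.+-mono-< 0<A 0<B)
    0<δ = *-pos (proj₁ (proj₂ C)) 0<ε
    X = cauchy x (proj₁ C ℚ.* ε) 0<δ
    Y = cauchy y (proj₁ C ℚ.* ε) 0<δ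
    N₃ = proj₁ X
    N₄ = proj₁ Y
    N₁₂≤ = ℕ.m≤m⊔n (N₁ ℕ.⊔ N₂) (N₃ ℕ.⊔ N₄)
    N₃₄≤ = ℕ.m≤n⊔m (N₁ ℕ.⊔ N₂) (N₃ ℕ.⊔ N₄)
    N₁≤ = ℕ.≤-trans (ℕ.m≤m⊔n N₁ N₂) N₁₂≤
    N₂≤ = ℕ.≤-trans (ℕ.m≤n⊔m N₁ N₂) N₁₂≤
    N₃≤ = ℕ.≤-trans (ℕ.m≤m⊔n N₃ N₄) N₃₄≤
    N₄≤ = ℕ.≤-trans (ℕ.m≤n⊔m N₃ N₄) N₃₄≤

infixr 8 _^_
_^_ : ℝ → ℕ → ℝ
x ^ zero  = fromℕ 1
x ^ suc n = x * x ^ n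

-- Apartness from zero: |x| is bounded below by a positive rational.
NonZero : ℝ → Set
NonZero x = fromℕ 0 < ∣ x ∣

-- Only the terms with q ≢ 0 matter for the inverse of a nonzero real.
inverse-or-0 : ℚ → ℚ
inverse-or-0 q with q ℚ.≟ 0ℚ
... | yes _  = 0ℚ
... | no q≢0 = (ℚ.1/ q) {{ℚ.≢-nonZero q≢0}}

inverse-or-0-inverse : ∀ q → q ≢ 0ℚ → inverse-or-0 q ℚ.* q ≡ 1ℚ
inverse-or-0-inverse q q≢0 with q ℚ.≟ 0ℚ
... | yes q≡0 = contradiction q≡0 q≢0
... | no  q≢0 = ℚ.*-inverseˡ q {{ℚ.≢-nonZero q≢0}}

0<δ≤∣q∣⇒q≢0 : ∀ {q δ} → 0ℚ ℚ.< δ → δ ℚ.≤ ℚ.∣ q ∣ → q ≢ 0ℚ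
0<δ≤∣q∣⇒q≢0 0<δ δ≤ refl = ℚ.<⇒≢ (ℚ.<-≤-trans 0<δ δ≤) refl

inverse-bound : ∀ {δ δ⁻¹} q → 0ℚ ℚ.< δ → δ⁻¹ ℚ.* δ ≡ 1ℚ → δ ℚ.≤ ℚ.∣ q ∣ →
                ℚ.∣ inverse-or-0 q ∣ ℚ.≤ δ⁻¹
inverse-bound {δ} q 0<δ e δ≤ = ℚ.*-cancelʳ-≤-pos δ {{ℚ.positive 0<δ}}
  (ℚ.≤-trans
    (ℚ.*-monoˡ-≤-nonNeg ℚ.∣ inverse-or-0 q ∣ {{ℚ.∣-∣-nonNeg (inverse-or-0 q)}} δ≤)
    (ℚ.≤-reflexive (trans (sym (ℚ.∣p*q∣≡∣p∣*∣q∣ (inverse-or-0 q) q))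
      (trans (cong ℚ.∣_∣ (inverse-or-0-inverse q (0<δ≤∣q∣⇒q≢0 0<δ δ≤))) (sym e)))))

inverse-close : ∀ {δ E ε} a b → 0ℚ ℚ.< δ → 0ℚ ℚ.< E → E ℚ.* δ ≡ 1ℚ →
  δ ℚ.≤ ℚ.∣ a ∣ → δ ℚ.≤ ℚ.∣ b ∣ → ℚ.∣ a ℚ.- b ∣ ℚ.< δ ℚ.* (δ ℚ.* ε) →
  ℚ.∣ inverse-or-0 a ℚ.- inverse-or-0 b ∣ ℚ.< ε
inverse-close {δ} {E} {ε} a b 0<δ 0<E Eδ≡1 δ≤a δ≤b a-b< = subst₂ ℚ._<_
  (sym (cong ℚ.∣_∣ (inverse-difference {i} {j}
    (inverse-or-0-inverse a (0<δ≤∣q∣⇒q≢0 0<δ δ≤a))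
    (inverse-or-0-inverse b (0<δ≤∣q∣⇒q≢0 0<δ δ≤b)))))
  (trans (ℚ.*-assoc E E (δ ℚ.* (δ ℚ.* ε)))
    (trans (cong (E ℚ.*_) (*-cancel-inverse E (δ ℚ.* ε) Eδ≡1)) (*-cancel-inverse E ε Eδ≡1)))
  (*-close₁ (i ℚ.* j) (b ℚ.- a) (*-pos 0<E 0<E)
    (ℚ.≤-trans (ℚ.≤-reflexive (ℚ.∣p*q∣≡∣p∣*∣q∣ i j))
      (*-mono-≤-nonNeg (ℚ.0≤∣p∣ j) (ℚ.<⇒≤ 0<E)
        (inverse-bound a 0<δ Eδ≡1 δ≤a) (inverse-bound b 0<δ Eδ≡1 δ≤b)))
    (ℚ.≤-<-trans (ℚ.≤-reflexive (∣p-q∣≡∣q-p∣ b a)) a-b<))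
  where
  i = inverse-or-0 a
  j = inverse-or-0 b

inverse : (x : ℝ) → NonZero x → ℝ
seq    (inverse x _)                         = λ n → inverse-or-0 (seq x n)
cauchy (inverse x (δ , 0<δ , N₁ , δ≤)) ε 0<ε = N₁ ℕ.⊔ N₂ , λ m n p q →
  inverse-close (seq x m) (seq x n) 0<δ (proj₁ (proj₂ E))
    (trans (ℚ.*-comm (proj₁ E) δ) (proj₂ (proj₂ E)))
    (δ≤∣x∣ m (ℕ.≤-trans (ℕ.m≤m⊔n N₁ N₂) p)) (δ≤∣x∣ n (ℕ.≤-trans (ℕ.m≤m⊔n N₁ N₂) q))
    (proj₂ X m n (ℕ.≤-trans (ℕ.m≤n⊔m N₁ N₂) p) (ℕ.≤-trans (ℕ.m≤n⊔m N₁ N₂) q))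
  where
  E = reciprocal 0<δ
  X = cauchy x (δ ℚ.* (δ ℚ.* ε)) (*-pos 0<δ (*-pos 0<δ 0<ε))
  N₂ = proj₁ X

  δ≤∣x∣ : ∀ n → N₁ ℕ.≤ n → δ ℚ.≤ ℚ.∣ seq x n ∣
  δ≤∣x∣ n N₁≤n = subst (ℚ._≤ ℚ.∣ seq x n ∣) (ℚ.+-identityˡ δ) (δ≤ n N₁≤n)

divide : (x y : ℝ) → NonZero y → ℝ
divide x y y≠0 = x * inverse y y≠0

-- ⌊√n⌋
isqrt : ℕ → ℕ
isqrt zero = 0
isqrt (suc n) with suc (isqrt n) ℕ.* suc (isqrt n) ℕ.≤? suc n
... | yes _ = suc (isqrt n)
... | no  _ = isqrt n

isqrt-lower : ∀ n → isqrt n ℕ.* isqrt n ℕ.≤ n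
isqrt-lower zero = z≤n
isqrt-lower (suc n) with suc (isqrt n) ℕ.* suc (isqrt n) ℕ.≤? suc n
... | yes p = p
... | no  _ = ℕ.m≤n⇒m≤1+n (isqrt-lower n)

isqrt-upper : ∀ n → n ℕ.< suc (isqrt n) ℕ.* suc (isqrt n)
isqrt-upper zero = s≤s z≤n
isqrt-upper (suc n) with suc (isqrt n) ℕ.* suc (isqrt n) ℕ.≤? suc n
... | yes _ = ℕ.≤-<-trans (isqrt-upper n)
      (ℕ.*-mono-< (ℕ.n<1+n (suc (isqrt n))) (ℕ.n<1+n (suc (isqrt n))))
... | no ¬p = ℕ.≰⇒> ¬p

positivePart : ℤ → ℕ
positivePart (+ n)    = n
positivePart -[1+ _ ] = 0

-- With q = a/b and N = n + 1 the numerator of the n-th approximation is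
-- ⌊√⌊aN²/b⌋⌋ = ⌊N√q⌋.
sqrtNumerator : ℚ → ℕ → ℕ
sqrtNumerator q n =
  isqrt ((positivePart (ℚ.↥ q) ℕ.* (suc n ℕ.* suc n)) ℕ./ ℚ.↧ₙ q)

sqrtNumerator-lower : ∀ q n → let s = sqrtNumerator q n in
  s ℕ.* s ℕ.* ℚ.↧ₙ q ℕ.≤ positivePart (ℚ.↥ q) ℕ.* (suc n ℕ.* suc n)
sqrtNumerator-lower q n = ℕ.≤-trans
  (ℕ.*-monoˡ-≤ (ℚ.↧ₙ q) (isqrt-lower (t ℕ./ ℚ.↧ₙ q)))
  (ℕ.m/n*n≤m t (ℚ.↧ₙ q))
  where t = positivePart (ℚ.↥ q) ℕ.* (suc n ℕ.* suc n)

sqrtNumerator-upper : ∀ q n → let s = suc (sqrtNumerator q n) in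
  positivePart (ℚ.↥ q) ℕ.* (suc n ℕ.* suc n) ℕ.< s ℕ.* s ℕ.* ℚ.↧ₙ q
sqrtNumerator-upper q n = ℕ.<-≤-trans
  (subst (ℕ._< suc (t ℕ./ ℚ.↧ₙ q) ℕ.* ℚ.↧ₙ q) (sym (ℕ.m≡m%n+[m/n]*n t (ℚ.↧ₙ q)))
    (ℕ.+-monoˡ-< ((t ℕ./ ℚ.↧ₙ q) ℕ.* ℚ.↧ₙ q) (ℕ.m%n<n t (ℚ.↧ₙ q))))
  (ℕ.*-monoˡ-≤ (ℚ.↧ₙ q) (isqrt-upper (t ℕ./ ℚ.↧ₙ q)))
  where t = positivePart (ℚ.↥ q) ℕ.* (suc n ℕ.* suc n)

square-cancel-< : ∀ a b → a ℕ.* a ℕ.< b ℕ.* b → a ℕ.< b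
square-cancel-< a b h with a ℕ.<? b
... | yes p = p
... | no ¬p = contradiction (ℕ.*-mono-≤ (ℕ.≮⇒≥ ¬p) (ℕ.≮⇒≥ ¬p)) (ℕ.<⇒≱ h)

sqrtNumerator-cross : ∀ q m n →
  sqrtNumerator q m ℕ.* suc n ℕ.≤ suc (sqrtNumerator q n) ℕ.* suc m
sqrtNumerator-cross q m n = ℕ.<⇒≤ (square-cancel-< (s ℕ.* N) (t ℕ.* M)
  (ℕ.*-cancelʳ-< (ℚ.↧ₙ q) (s ℕ.* N ℕ.* (s ℕ.* N)) (t ℕ.* M ℕ.* (t ℕ.* M))
    (subst₂ ℕ._<_ (e₁ s N (ℚ.↧ₙ q)) (e₁ t M (ℚ.↧ₙ q))
      (ℕ.≤-<-trans
        (ℕ.*-monoˡ-≤ (N ℕ.* N) (sqrtNumerator-lower q m))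
        (subst (ℕ._< t ℕ.* t ℕ.* ℚ.↧ₙ q ℕ.* (M ℕ.* M)) (e₂ (positivePart (ℚ.↥ q)) M N)
          (ℕ.*-monoˡ-< (M ℕ.* M) (sqrtNumerator-upper q n)))))))
  where
  M = suc m
  N = suc n
  s = sqrtNumerator q m
  t = suc (sqrtNumerator q n)
  e₁ : ∀ s N d → s ℕ.* s ℕ.* d ℕ.* (N ℕ.* N) ≡ s ℕ.* N ℕ.* (s ℕ.* N) ℕ.* d
  e₁ = solve-∀
  e₂ : ∀ p M N → p ℕ.* (N ℕ.* N) ℕ.* (M ℕ.* M) ≡ p ℕ.* (M ℕ.* M) ℕ.* (N ℕ.* N)
  e₂ = solve-∀

-- The nonnegative square root of q when 0 ≤ q; it is 0 when q is negative.
√ : ℚ → ℝ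
seq    (√ q)       = λ n → + sqrtNumerator q n ℚ./ suc n
cauchy (√ q) ε 0<ε with N , 1/N<ε ← archimedean ε 0<ε = N , λ m n p q →
  ℚ.≤-<-trans (∣p-q∣-elim (ℚ._≤ (+ 1 ℚ./ suc N)) (s m) (s n) (close m n q) (close n m p)) 1/N<ε
  where
  s : ℕ → ℚ
  s n = + sqrtNumerator q n ℚ./ suc n

  close : ∀ {N} m n → N ℕ.≤ n → s m ℚ.- s n ℚ.≤ (+ 1 ℚ./ suc N)
  close {N} m n N≤n = p≤r+q⇒p-q≤r (s m) (s n) (+ 1 ℚ./ suc N) (ℚ.≤-trans
    (ℚ.≤-trans
      (/-mono-≤ (sqrtNumerator q m) (suc (sqrtNumerator q n)) m n (sqrtNumerator-cross q m n))
      (ℚ.≤-reflexive (/-suc (sqrtNumerator q n) n)))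
    (ℚ.+-monoˡ-≤ (s n) (/-mono-≤ 1 1 n N (ℕ.*-monoʳ-≤ 1 (s≤s N≤n)))))

private
  1≤√-terms : ∀ q → 1ℚ ℚ.≤ q → ∀ n → 1ℚ ℚ.≤ seq (√ q) n
  1≤√-terms q@(mkℚ (+ a) d _) (ℚ.*≤* h) n =
    /-mono-≤ 1 (sqrtNumerator q n) 0 n (subst₂ ℕ._≤_
      (sym (ℕ.*-identityˡ (suc n))) (sym (ℕ.*-identityʳ (sqrtNumerator q n)))
      (ℕ.≤-pred (square-cancel-< (suc n) (suc (sqrtNumerator q n))
        (ℕ.*-cancelʳ-< (suc d) (suc n ℕ.* suc n) _ (ℕ.≤-<-trans
          (ℕ.≤-trans (ℕ.≤-reflexive (ℕ.*-comm (suc n ℕ.* suc n) (suc d)))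
            (ℕ.*-monoˡ-≤ (suc n ℕ.* suc n) d≤a))
          (sqrtNumerator-upper q n))))))
    where
    d≤a : suc d ℕ.≤ a
    d≤a = ℤ.drop‿+≤+ (subst₂ ℤ._≤_ (ℤ.*-identityˡ (+ suc d)) (ℤ.*-identityʳ (+ a)) h)
  1≤√-terms (mkℚ -[1+ _ ] _ _) (ℚ.*≤* ())

  1≤p⇒1≤∣p∣ : ∀ p → 1ℚ ℚ.≤ p → 1ℚ ℚ.≤ ℚ.∣ p ∣
  1≤p⇒1≤∣p∣ p 1≤p = subst (1ℚ ℚ.≤_)
    (sym (ℚ.0≤p⇒∣p∣≡p (ℚ.≤-trans (ℚ.nonNegative⁻¹ 1ℚ) 1≤p))) 1≤p

c√q-nonZero : ∀ c q → 1ℚ ℚ.≤ q → NonZero (fromℕ (suc c) * √ q)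
c√q-nonZero c q 1≤q = 1ℚ , ℚ.positive⁻¹ 1ℚ , 0 , λ n _ →
  1≤p⇒1≤∣p∣ _ (*-mono-≤-nonNeg {1ℚ} {+ suc c ℚ./ 1} {1ℚ} {seq (√ q) n}
    (ℚ.nonNegative⁻¹ 1ℚ) (ℚ.nonNegative⁻¹ _ {{ℚ.normalize-nonNeg (suc c) 1}})
    (/-mono-≤ 1 (suc c) 0 0 (s≤s z≤n)) (1≤√-terms q 1≤q n))

36√6≠0 : NonZero (fromℕ 36 * √ (+ 6 ℚ./ 1))
36√6≠0 = c√q-nonZero 35 (+ 6 ℚ./ 1) (from-yes (1ℚ ℚ.≤? + 6 ℚ./ 1))

108√10≠0 : NonZero (fromℕ 108 * √ (+ 10 ℚ./ 1))
108√10≠0 = c√q-nonZero 107 (+ 10 ℚ./ 1) (from-yes (1ℚ ℚ.≤? + 10 ℚ./ 1))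

-- a(n) / b(n) → 1 as n → ∞ through the n satisfying P; that the quotient
-- is eventually defined is part of the assertion.
_∼_through_ : (ℕ → ℝ) → (ℕ → ℝ) → (ℕ → Set) → Set
a ∼ b through P =
  ∀ ε → 0ℚ ℚ.< ε → ∃ λ N → ∀ n → N ℕ.≤ n → P n →
  ∃ λ (b≠0 : NonZero (b n)) → ∣ divide (a n) (b n) b≠0 - fromℕ 1 ∣ < fromℚ ε

-- The fraction a/b; the value at b = 0 is a dummy.
infixl 7 _÷_
_÷_ : ℕ → ℕ → ℚ
a ÷ zero  = 0ℚ
a ÷ suc b = + a ℚ./ suc b

-- For n ≥ 4 all denominators are nonzero, the radicand is nonnegative and
-- all subtractions of naturals are exact; smaller n play no role in the asymptotics.
x₋ : ℕ → ℝ
x₋ n =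
  - fromℚ (D n (d ℕ.∸ 1) ÷ (d ℕ.* D n d))
  - fromℚ ((d ℕ.∸ 1) ÷ d)
    * √ ((D n (d ℕ.∸ 1) ÷ D n d) ℚ.* (D n (d ℕ.∸ 1) ÷ D n d)
         ℚ.- ((2 ℕ.* d) ÷ (d ℕ.∸ 1)) ℚ.* (D n (d ℕ.∸ 2) ÷ D n d))
  where d = n ℕ./ 2

{-# OPTIONS --safe #-}

-- Splitting off the block of the first element shows that D(n,k) has the exponential generating
-- function (eˣ − 1 − x)ᵏ / k! in n, whence D(n+2,k+1) = (k+1) D(n+1,k+1) + (n+1) D(n,k).  Solving
-- this recurrence near the diagonal n = 2k writes D(n,d−1)/D(n,d) and D(n,d−2)/D(n,d) as
-- polynomials in d of degrees 3 and 6, with leading coefficients 1/9 and 1/486 for even n, and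
-- 1/27 and 1/2430 for odd n.  The radicand is then asymptotic to 2d⁶/243, respectively 2d⁶/3645,
-- the first term of x₋ is only O(d²), and comparing squares avoids real arithmetic: the product
-- of the approximations of the two square roots is squeezed between 1 − ε and 1 + ε because its
-- square is.
module Submission where

-- `D` filters a list of all families of subsets, so the counting is done on lists. It is
-- generalised from the ground set to an arbitrary subset U of it, because removing a block leaves a
-- subset of the same `Fin n` rather than a smaller `Fin`. The asymptotics are robust because the
-- leading terms of the radicand do not cancel: 1/81 - 2/486 = 2/243 and 1/729 - 2/2430 = 2/3645.
-- Leading coefficients with errors of relative size 1/d therefore suffice. Since d is
-- asymptotically n/2, the constants arise as √(2/243)/8 = 1/(36√6) and √(2/3645)/8 = 1/(108√10). As
-- `√` vanishes on negative rationals, the radicand must also be shown to be nonnegative; this too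
-- is read off from the limit.

module Counting where

  open import Defs using (subsets; sublists; families; IsPartition; mkIsPartition; isPartitionWithoutSingletons?; D)
  open import Data.Fin.Subset as Subset using (Subset; inside; outside; Nonempty; Empty; _∈_; _∉_; _⊆_; _∩_; _─_; ⊤)
  open import Data.Fin.Subset.Properties
  open import Data.List.Base as List using (List; []; _∷_; _++_; length; filter)
  open import Data.List.Relation.Unary.All as All using (All; []; _∷_)
  open import Data.List.Relation.Unary.AllPairs using (AllPairs; []; _∷_)
  open import Data.List.Relation.Unary.Any as Any using (Any; here; there)
  open import Data.Nat.Base
  open import Data.Nat.Properties
  open import Data.Nat.Tactic.RingSolver using (solve-∀)
  open import Data.Product.Base using (_,_)
  open import Data.Vec.Base using ([]; _∷_; here; there)
  open import Function.Base using (_∘_)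
  open import Relation.Binary.PropositionalEquality
  open import Relation.Nullary using (yes; no; contradiction)
  open import Relation.Unary using (Decidable)
  open ≡-Reasoning

  -- Binomial convolution and associated Stirling numbers

  -- The binomial convolution: (h ⊛ g) n is the sum of C(n,j) h(j) g(n−j), computed by the
  -- product rule for exponential generating functions, whose derivative is the shift _∘ suc.
  infixl 7 _⊛_
  _⊛_ : (ℕ → ℕ) → (ℕ → ℕ) → ℕ → ℕ
  (h ⊛ g) zero    = h 0 * g 0
  (h ⊛ g) (suc n) = (h ⊛ (g ∘ suc)) n + ((h ∘ suc) ⊛ g) n

  ⊛-congʳ : ∀ h {g g′} → g ≗ g′ → h ⊛ g ≗ h ⊛ g′
  ⊛-congʳ h e zero    = cong (h 0 *_) (e 0)
  ⊛-congʳ h e (suc n) = cong₂ _+_ (⊛-congʳ h (e ∘ suc) n) (⊛-congʳ (h ∘ suc) e n)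

  ⊛-zeroʳ : ∀ h → h ⊛ (λ _ → 0) ≗ (λ _ → 0)
  ⊛-zeroʳ h zero    = *-zeroʳ (h 0)
  ⊛-zeroʳ h (suc n) = cong₂ _+_ (⊛-zeroʳ h n) (⊛-zeroʳ (h ∘ suc) n)

  ⊛-zeroˡ : ∀ g → (λ _ → 0) ⊛ g ≗ (λ _ → 0)
  ⊛-zeroˡ g zero    = refl
  ⊛-zeroˡ g (suc n) = cong₂ _+_ (⊛-zeroˡ (g ∘ suc) n) (⊛-zeroˡ g n)

  +-interchange : ∀ a b c d → (a + b) + (c + d) ≡ (a + c) + (b + d)
  +-interchange = solve-∀

  ⊛-distribˡ-+ : ∀ h g g′ → h ⊛ (λ n → g n + g′ n) ≗ (λ n → (h ⊛ g) n + (h ⊛ g′) n)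
  ⊛-distribˡ-+ h g g′ zero    = *-distribˡ-+ (h 0) (g 0) (g′ 0)
  ⊛-distribˡ-+ h g g′ (suc n) = trans
    (cong₂ _+_ (⊛-distribˡ-+ h (g ∘ suc) (g′ ∘ suc) n) (⊛-distribˡ-+ (h ∘ suc) g g′ n))
    (+-interchange ((h ⊛ (g ∘ suc)) n) _ _ _)

  ⊛-distribʳ-+ : ∀ g h h′ → (λ n → h n + h′ n) ⊛ g ≗ (λ n → (h ⊛ g) n + (h′ ⊛ g) n)
  ⊛-distribʳ-+ g h h′ zero    = *-distribʳ-+ (g 0) (h 0) (h′ 0)
  ⊛-distribʳ-+ g h h′ (suc n) = trans
    (cong₂ _+_ (⊛-distribʳ-+ (g ∘ suc) h h′ n) (⊛-distribʳ-+ g (h ∘ suc) (h′ ∘ suc) n))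
    (+-interchange ((h ⊛ (g ∘ suc)) n) _ _ _)

  ⊛-*ʳ : ∀ c h g → h ⊛ (λ n → c * g n) ≗ (λ n → c * (h ⊛ g) n)
  ⊛-*ʳ c h g zero    = lemma c (h 0) (g 0)
    where
    lemma : ∀ c x y → x * (c * y) ≡ c * (x * y)
    lemma = solve-∀
  ⊛-*ʳ c h g (suc n) = trans
    (cong₂ _+_ (⊛-*ʳ c h (g ∘ suc) n) (⊛-*ʳ c (h ∘ suc) g n))
    (sym (*-distribˡ-+ c ((h ⊛ (g ∘ suc)) n) _))

  -- Differentiating either side gives the same three products, one for each differentiated factor,
  -- in a different order.
  ⊛-leftComm : ∀ f h g → f ⊛ (h ⊛ g) ≗ h ⊛ (f ⊛ g)
  ⊛-leftComm f h g zero    = lemma (f 0) (h 0) (g 0)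
    where
    lemma : ∀ x y z → x * (y * z) ≡ y * (x * z)
    lemma = solve-∀
  ⊛-leftComm f h g (suc n) = begin
    (f ⊛ ((h ⊛ g) ∘ suc)) n + ((f ∘ suc) ⊛ (h ⊛ g)) n
      ≡⟨ cong₂ _+_ (⊛-distribˡ-+ f (h ⊛ (g ∘ suc)) ((h ∘ suc) ⊛ g) n) refl ⟩
    (f ⊛ (h ⊛ (g ∘ suc))) n + (f ⊛ ((h ∘ suc) ⊛ g)) n + ((f ∘ suc) ⊛ (h ⊛ g)) n
      ≡⟨ cong₂ _+_ (cong₂ _+_ (⊛-leftComm f h (g ∘ suc) n) (⊛-leftComm f (h ∘ suc) g n))
          (⊛-leftComm (f ∘ suc) h g n) ⟩
    (h ⊛ (f ⊛ (g ∘ suc))) n + ((h ∘ suc) ⊛ (f ⊛ g)) n + (h ⊛ ((f ∘ suc) ⊛ g)) n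
      ≡⟨ lemma ((h ⊛ (f ⊛ (g ∘ suc))) n) _ _ ⟩
    (h ⊛ (f ⊛ (g ∘ suc))) n + (h ⊛ ((f ∘ suc) ⊛ g)) n + ((h ∘ suc) ⊛ (f ⊛ g)) n
      ≡⟨ cong₂ _+_ (⊛-distribˡ-+ h (f ⊛ (g ∘ suc)) ((f ∘ suc) ⊛ g) n) refl ⟨
    (h ⊛ ((f ⊛ g) ∘ suc)) n + ((h ∘ suc) ⊛ (f ⊛ g)) n ∎
    where
    lemma : ∀ x y z → x + y + z ≡ x + z + y
    lemma = solve-∀

  -- Their exponential generating functions are 1, x and eˣ - 1 - x.
  [0] [1] [≥2] : ℕ → ℕ
  [0] zero    = 1
  [0] (suc _) = 0
  [1] zero    = 0
  [1] (suc n) = [0] n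
  [≥2] 0             = 0
  [≥2] 1             = 0
  [≥2] (suc (suc _)) = 1

  ⊛-identityˡ : ∀ g → [0] ⊛ g ≗ g
  ⊛-identityˡ g zero    = +-identityʳ (g 0)
  ⊛-identityˡ g (suc n) = trans (cong₂ _+_ (⊛-identityˡ (g ∘ suc) n) (⊛-zeroˡ g n)) (+-identityʳ _)

  -- Multiplication by x shifts the coefficients; the factor n + 1 comes from the factorials in an
  -- exponential generating function.
  [1]⊛ : ∀ g n → ([1] ⊛ g) (suc n) ≡ suc n * g n
  [1]⊛ g zero    = cong (_+ (g 0 + 0)) {0} refl
  [1]⊛ g (suc n) = trans (cong₂ _+_ ([1]⊛ (g ∘ suc) n) (⊛-identityˡ g (suc n)))
    (+-comm (suc n * g (suc n)) (g (suc n)))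

  -- Associated Stirling numbers of the second kind; F k has the exponential generating
  -- function (eˣ − 1 − x)ᵏ / k!, and [≥2] ∘ suc that of eˣ − 1.
  F : ℕ → ℕ → ℕ
  F zero    n       = [0] n
  F (suc k) zero    = 0
  F (suc k) (suc n) = (([≥2] ∘ suc) ⊛ F k) n

  -- With f = eˣ - 1 - x this reads f · fᵏ/k! = (k+1) · fᵏ⁺¹/(k+1)!. To avoid division it is proved
  -- by differentiation: the derivative of f · fᵏ/k! is f · f′fᵏ⁻¹/(k-1)! + f′ · fᵏ/k!, where the
  -- first summand is k copies of the second by the case k - 1.
  [≥2]⊛F : ∀ k → [≥2] ⊛ F k ≗ (λ n → suc k * F (suc k) n)
  [≥2]⊛F k       zero    = sym (*-zeroʳ (suc k))
  [≥2]⊛F zero    (suc n) = trans (cong (_+ F 1 (suc n)) (⊛-zeroʳ [≥2] n)) (sym (+-identityʳ _))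
  [≥2]⊛F (suc k) (suc n) = begin
    ([≥2] ⊛ (([≥2] ∘ suc) ⊛ F k)) n + F (suc (suc k)) (suc n)
      ≡⟨ cong₂ _+_ (⊛-leftComm [≥2] ([≥2] ∘ suc) (F k) n) refl ⟩
    (([≥2] ∘ suc) ⊛ ([≥2] ⊛ F k)) n + F (suc (suc k)) (suc n)
      ≡⟨ cong₂ _+_ (⊛-congʳ ([≥2] ∘ suc) ([≥2]⊛F k) n) refl ⟩
    (([≥2] ∘ suc) ⊛ (λ m → suc k * F (suc k) m)) n + F (suc (suc k)) (suc n)
      ≡⟨ cong₂ _+_ (⊛-*ʳ (suc k) ([≥2] ∘ suc) (F (suc k)) n) refl ⟩
    suc k * F (suc (suc k)) (suc n) + F (suc (suc k)) (suc n)
      ≡⟨ +-comm (suc k * F (suc (suc k)) (suc n)) _ ⟩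
    suc (suc k) * F (suc (suc k)) (suc n) ∎

  [≥1]≗[≥2]+[1] : [≥2] ∘ suc ≗ (λ n → [≥2] n + [1] n)
  [≥1]≗[≥2]+[1] 0             = refl
  [≥1]≗[≥2]+[1] 1             = refl
  [≥1]≗[≥2]+[1] (suc (suc n)) = refl

  ⊛-congˡ : ∀ {h h′} g → h ≗ h′ → h ⊛ g ≗ h′ ⊛ g
  ⊛-congˡ g e zero    = cong (_* g 0) (e 0)
  ⊛-congˡ g e (suc n) = cong₂ _+_ (⊛-congˡ (g ∘ suc) e n) (⊛-congˡ g (e ∘ suc) n)

  -- For f = eˣ - 1 - x one has f′ = f + x, so fᵏ⁺¹/(k+1)! has derivative f · fᵏ/k! + x · fᵏ/k!.
  -- Combinatorially, deleting one fixed element either leaves its block with at least two elements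
  -- or breaks up a pair.
  F-rec : ∀ k n → F (suc k) (2 + n) ≡ suc k * F (suc k) (suc n) + suc n * F k n
  F-rec k n = begin
    (([≥2] ∘ suc) ⊛ F k) (suc n)
      ≡⟨ ⊛-congˡ (F k) [≥1]≗[≥2]+[1] (suc n) ⟩
    ((λ m → [≥2] m + [1] m) ⊛ F k) (suc n)
      ≡⟨ ⊛-distribʳ-+ (F k) [≥2] [1] (suc n) ⟩
    ([≥2] ⊛ F k) (suc n) + ([1] ⊛ F k) (suc n)
      ≡⟨ cong₂ _+_ ([≥2]⊛F k (suc n)) ([1]⊛ (F k) n) ⟩
    suc k * F (suc k) (suc n) + suc n * F k n ∎

  -- Removing blocks from a set

  -- take x g U is g (U ─ x) if x ⊆ U, and 0 otherwise.
  take : ∀ {n} → Subset n → (Subset n → ℕ) → Subset n → ℕ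
  take []            g []            = g []
  take (outside ∷ x) g (u ∷ U)       = take x (g ∘ (u ∷_)) U
  take (inside ∷ x)  g (inside ∷ U)  = take x (g ∘ (outside ∷_)) U
  take (inside ∷ x)  g (outside ∷ U) = 0

  take-cong : ∀ {n} (x : Subset n) {g h} → g ≗ h → take x g ≗ take x h
  take-cong []            e []            = e []
  take-cong (outside ∷ x) e (u ∷ U)       = take-cong x (e ∘ (u ∷_)) U
  take-cong (inside ∷ x)  e (inside ∷ U)  = take-cong x (e ∘ (outside ∷_)) U
  take-cong (inside ∷ x)  e (outside ∷ U) = refl

  take-zero : ∀ {n} (x : Subset n) → take x (λ _ → 0) ≗ (λ _ → 0)
  take-zero []            []            = refl
  take-zero (outside ∷ x) (u ∷ U)       = take-zero x U
  take-zero (inside ∷ x)  (inside ∷ U)  = take-zero x U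
  take-zero (inside ∷ x)  (outside ∷ U) = refl

  take-+ : ∀ {n} (x : Subset n) g h → take x (λ V → g V + h V) ≗ (λ U → take x g U + take x h U)
  take-+ []            g h []            = refl
  take-+ (outside ∷ x) g h (u ∷ U)       = take-+ x (g ∘ (u ∷_)) (h ∘ (u ∷_)) U
  take-+ (inside ∷ x)  g h (inside ∷ U)  = take-+ x (g ∘ (outside ∷_)) (h ∘ (outside ∷_)) U
  take-+ (inside ∷ x)  g h (outside ∷ U) = refl

  take-* : ∀ {n} c (x : Subset n) g → take x (λ V → c * g V) ≗ (λ U → c * take x g U)
  take-* c []            g []            = refl
  take-* c (outside ∷ x) g (u ∷ U)       = take-* c x (g ∘ (u ∷_)) U
  take-* c (inside ∷ x)  g (inside ∷ U)  = take-* c x (g ∘ (outside ∷_)) U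
  take-* c (inside ∷ x)  g (outside ∷ U) = sym (*-zeroʳ c)

  -- Both sides are `g (U ─ x ─ y)` if x and y are disjoint and contained in U, and 0 otherwise.
  -- This makes the order in which blocks are chosen irrelevant.
  take-comm : ∀ {n} (x y : Subset n) g → take x (take y g) ≗ take y (take x g)
  take-comm []            []            g []            = refl
  take-comm (outside ∷ x) (outside ∷ y) g (u ∷ U)       = take-comm x y (g ∘ (u ∷_)) U
  take-comm (outside ∷ x) (inside ∷ y)  g (inside ∷ U)  = take-comm x y (g ∘ (outside ∷_)) U
  take-comm (outside ∷ x) (inside ∷ y)  g (outside ∷ U) = take-zero x U
  take-comm (inside ∷ x)  (outside ∷ y) g (inside ∷ U)  = take-comm x y (g ∘ (outside ∷_)) U
  take-comm (inside ∷ x)  (outside ∷ y) g (outside ∷ U) = sym (take-zero y U)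
  take-comm (inside ∷ x)  (inside ∷ y)  g (inside ∷ U)  = trans (take-zero x U) (sym (take-zero y U))
  take-comm (inside ∷ x)  (inside ∷ y)  g (outside ∷ U) = refl

  take-⊆ : ∀ {n} (x : Subset n) g U → x ⊆ U → take x g U ≡ g (U ─ x)
  take-⊆ []            g []            _ = refl
  take-⊆ (outside ∷ x) g (u ∷ U)       x⊆U = take-⊆ x (g ∘ (u ∷_)) U (drop-∷-⊆ x⊆U)
  take-⊆ (inside ∷ x)  g (inside ∷ U)  x⊆U = take-⊆ x (g ∘ (outside ∷_)) U (drop-∷-⊆ x⊆U)
  take-⊆ (inside ∷ x)  g (outside ∷ U) x⊆U = contradiction (x⊆U here) λ ()

  take≢0⇒⊆ : ∀ {n} (x : Subset n) g U → take x g U ≢ 0 → x ⊆ U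
  take≢0⇒⊆ []            g []            ≢0 ()
  take≢0⇒⊆ (outside ∷ x) g (u ∷ U)       ≢0 = out⊆ (take≢0⇒⊆ x (g ∘ (u ∷_)) U ≢0)
  take≢0⇒⊆ (inside ∷ x)  g (inside ∷ U)  ≢0 = in⊆in (take≢0⇒⊆ x (g ∘ (outside ∷_)) U ≢0)
  take≢0⇒⊆ (inside ∷ x)  g (outside ∷ U) ≢0 = contradiction refl ≢0

  -- A weighted choice of one block. The weight is a separate argument because S will be the block
  -- of the first element with that element removed, which shifts the size condition to
  -- `[≥2] ∘ suc`.
  takeAny : ∀ {n} → List (Subset n) → (ℕ → ℕ) → (Subset n → ℕ) → Subset n → ℕ
  takeAny []       w g U = 0
  takeAny (S ∷ Ss) w g U = w Subset.∣ S ∣ * take S g U + takeAny Ss w g U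

  takeAny-cong : ∀ {n} (Ss : List (Subset n)) w {g h} → g ≗ h → takeAny Ss w g ≗ takeAny Ss w h
  takeAny-cong []       w e U = refl
  takeAny-cong (S ∷ Ss) w e U = cong₂ _+_ (cong (w Subset.∣ S ∣ *_) (take-cong S e U)) (takeAny-cong Ss w e U)

  takeAny-++ : ∀ {n} (Ss Ts : List (Subset n)) w g U →
               takeAny (Ss ++ Ts) w g U ≡ takeAny Ss w g U + takeAny Ts w g U
  takeAny-++ []       Ts w g U = refl
  takeAny-++ (S ∷ Ss) Ts w g U =
    trans (cong (_ +_) (takeAny-++ Ss Ts w g U)) (sym (+-assoc (w Subset.∣ S ∣ * take S g U) _ _))

  takeAny-+ : ∀ {n} (Ss : List (Subset n)) w g h U →
              takeAny Ss w (λ V → g V + h V) U ≡ takeAny Ss w g U + takeAny Ss w h U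
  takeAny-+ []       w g h U = refl
  takeAny-+ (S ∷ Ss) w g h U = begin
    w s * take S (λ V → g V + h V) U + takeAny Ss w (λ V → g V + h V) U
      ≡⟨ cong₂ _+_ (trans (cong (w s *_) (take-+ S g h U)) (*-distribˡ-+ (w s) _ _)) (takeAny-+ Ss w g h U) ⟩
    (w s * take S g U + w s * take S h U) + (takeAny Ss w g U + takeAny Ss w h U)
      ≡⟨ +-interchange (w s * take S g U) _ _ _ ⟩
    (w s * take S g U + takeAny Ss w g U) + (w s * take S h U + takeAny Ss w h U) ∎
    where s = Subset.∣ S ∣

  -- By `take-comm`, the freely chosen block and the fixed block x can be removed in either order.
  takeAny-*take : ∀ {n} (Ss : List (Subset n)) w c x g U →
                  takeAny Ss w (λ V → c * take x g V) U ≡ c * take x (takeAny Ss w g) U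
  takeAny-*take []       w c x g U = sym (trans (cong (c *_) (take-zero x U)) (*-zeroʳ c))
  takeAny-*take (S ∷ Ss) w c x g U = begin
    w s * take S (λ V → c * take x g V) U + takeAny Ss w (λ V → c * take x g V) U
      ≡⟨ cong₂ _+_ (cong (w s *_) (trans (take-* c S (take x g) U) (cong (c *_) (take-comm S x g U))))
          (takeAny-*take Ss w c x g U) ⟩
    w s * (c * take x (take S g) U) + c * take x (takeAny Ss w g) U
      ≡⟨ lemma (w s) c _ _ ⟩
    c * (w s * take x (take S g) U + take x (takeAny Ss w g) U)
      ≡⟨ cong (λ z → c * (z + take x (takeAny Ss w g) U)) (take-* (w s) x (take S g) U) ⟨
    c * (take x (λ V → w s * take S g V) U + take x (takeAny Ss w g) U)
      ≡⟨ cong (c *_) (take-+ x (λ V → w s * take S g V) (takeAny Ss w g) U) ⟨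
    c * take x (takeAny (S ∷ Ss) w g) U ∎
    where
    s = Subset.∣ S ∣
    lemma : ∀ a c p q → a * (c * p) + c * q ≡ c * (a * p + q)
    lemma = solve-∀

  takeAny-outside : ∀ {n} (Ss : List (Subset n)) w g u U →
    takeAny (List.map (outside ∷_) Ss) w g (u ∷ U) ≡ takeAny Ss w (g ∘ (u ∷_)) U
  takeAny-outside []       w g u U = refl
  takeAny-outside (S ∷ Ss) w g u U = cong (_ +_) (takeAny-outside Ss w g u U)

  takeAny-inside-inside : ∀ {n} (Ss : List (Subset n)) w g U →
    takeAny (List.map (inside ∷_) Ss) w g (inside ∷ U) ≡ takeAny Ss (w ∘ suc) (g ∘ (outside ∷_)) U
  takeAny-inside-inside []       w g U = refl
  takeAny-inside-inside (S ∷ Ss) w g U = cong (_ +_) (takeAny-inside-inside Ss w g U)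

  takeAny-inside-outside : ∀ {n} (Ss : List (Subset n)) w g U →
    takeAny (List.map (inside ∷_) Ss) w g (outside ∷ U) ≡ 0
  takeAny-inside-outside []       w g U = refl
  takeAny-inside-outside (S ∷ Ss) w g U =
    cong₂ _+_ (*-zeroʳ (w (suc Subset.∣ S ∣))) (takeAny-inside-outside Ss w g U)

  -- U has C(|U|, j) subsets of size j, which is the coefficient in the convolution. In the
  -- induction an element of U goes either to the remainder, shifting γ, or to the chosen subset,
  -- shifting w: the two terms of the product rule.
  takeAny-subsets : ∀ {n} w γ (U : Subset n) →
    takeAny (subsets n) w (γ ∘ Subset.∣_∣) U ≡ (w ⊛ γ) Subset.∣ U ∣
  takeAny-subsets {zero}  w γ [] = +-identityʳ (w 0 * γ 0)
  takeAny-subsets {suc n} w γ (outside ∷ U) = begin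
    takeAny (subsets (suc n)) w (γ ∘ Subset.∣_∣) (outside ∷ U)
      ≡⟨ takeAny-++ (List.map (outside ∷_) (subsets n)) _ w _ (outside ∷ U) ⟩
    takeAny (List.map (outside ∷_) (subsets n)) w (γ ∘ Subset.∣_∣) (outside ∷ U) + _
      ≡⟨ cong₂ _+_ (trans (takeAny-outside (subsets n) w _ outside U) (takeAny-subsets w γ U))
          (takeAny-inside-outside (subsets n) w _ U) ⟩
    (w ⊛ γ) Subset.∣ U ∣ + 0
      ≡⟨ +-identityʳ _ ⟩
    (w ⊛ γ) Subset.∣ U ∣ ∎
  takeAny-subsets {suc n} w γ (inside ∷ U) = begin
    takeAny (subsets (suc n)) w (γ ∘ Subset.∣_∣) (inside ∷ U)
      ≡⟨ takeAny-++ (List.map (outside ∷_) (subsets n)) _ w _ (inside ∷ U) ⟩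
    takeAny (List.map (outside ∷_) (subsets n)) w (γ ∘ Subset.∣_∣) (inside ∷ U) + _
      ≡⟨ cong₂ _+_ (trans (takeAny-outside (subsets n) w _ inside U) (takeAny-subsets w (γ ∘ suc) U))
          (trans (takeAny-inside-inside (subsets n) w _ U) (takeAny-subsets (w ∘ suc) γ U)) ⟩
    (w ⊛ γ) (suc Subset.∣ U ∣) ∎

  -- Counting partitions block by block

  -- With base case g = isEmpty, the number of sublists of the list that partition U into
  -- k blocks of more than one element.
  count : ∀ {n} → List (Subset n) → (ℕ → Subset n → ℕ) → ℕ → Subset n → ℕ
  count []       g k       U = g k U
  count (x ∷ xs) g zero    U = count xs g zero U
  count (x ∷ xs) g (suc k) U = count xs g (suc k) U + [≥2] Subset.∣ x ∣ * take x (count xs g k) U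

  isEmpty : ∀ {n} → ℕ → Subset n → ℕ
  isEmpty k U = [0] k * [0] Subset.∣ U ∣

  count-cong : ∀ {n} (xs : List (Subset n)) {g h} → (∀ k → g k ≗ h k) → ∀ k → count xs g k ≗ count xs h k
  count-cong []       e k       U = e k U
  count-cong (x ∷ xs) e zero    U = count-cong xs e zero U
  count-cong (x ∷ xs) e (suc k) U =
    cong₂ _+_ (count-cong xs e (suc k) U) (cong ([≥2] Subset.∣ x ∣ *_) (take-cong x (count-cong xs e k) U))

  -- This is why the base case of `count` is a parameter: counting with the second list serves as
  -- the base case for the first. It separates the subsets without the first element from those
  -- containing it.
  count-++ : ∀ {n} (xs ys : List (Subset n)) g k → count (xs ++ ys) g k ≗ count xs (count ys g) k
  count-++ []       ys g k       U = refl
  count-++ (x ∷ xs) ys g zero    U = count-++ xs ys g zero U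
  count-++ (x ∷ xs) ys g (suc k) U =
    cong₂ _+_ (count-++ xs ys g (suc k) U) (cong ([≥2] Subset.∣ x ∣ *_) (take-cong x (count-++ xs ys g k) U))

  count-outside : ∀ {n} (xs : List (Subset n)) g k u U →
    count (List.map (outside ∷_) xs) g k (u ∷ U) ≡ count xs (λ j V → g j (u ∷ V)) k U
  count-outside []       g k       u U = refl
  count-outside (x ∷ xs) g zero    u U = count-outside xs g zero u U
  count-outside (x ∷ xs) g (suc k) u U = cong₂ _+_ (count-outside xs g (suc k) u U)
    (cong ([≥2] Subset.∣ x ∣ *_) (take-cong x (count-outside xs g k u) U))

  count-inside-outside : ∀ {n} (xs : List (Subset n)) g k U →
    count (List.map (inside ∷_) xs) g k (outside ∷ U) ≡ g k (outside ∷ U)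
  count-inside-outside []       g k       U = refl
  count-inside-outside (x ∷ xs) g zero    U = count-inside-outside xs g zero U
  count-inside-outside (x ∷ xs) g (suc k) U = trans
    (cong₂ _+_ (count-inside-outside xs g (suc k) U) (*-zeroʳ ([≥2] (suc Subset.∣ x ∣))))
    (+-identityʳ _)

  -- The contribution of the block of the first element: S is the rest of that block, hence the
  -- weight `[≥2] ∘ suc`. With no blocks available there is none to contain that element.
  addBlock : ∀ {n} → List (Subset n) → (ℕ → Subset n → ℕ) → ℕ → Subset n → ℕ
  addBlock Ss g zero    U = 0
  addBlock Ss g (suc k) U = takeAny Ss ([≥2] ∘ suc) (g k) U

  -- Exactly one block contains the first element. Once it is removed, the remaining set has
  -- `outside` in front, and `count-inside-outside` rules out any further block of this kind.
  count-inside-inside : ∀ {n} (xs : List (Subset n)) k U →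
    count (List.map (inside ∷_) xs) isEmpty k (inside ∷ U) ≡ addBlock xs isEmpty k U
  count-inside-inside []       zero    U = refl
  count-inside-inside []       (suc k) U = refl
  count-inside-inside (x ∷ xs) zero    U = count-inside-inside xs zero U
  count-inside-inside (x ∷ xs) (suc k) U = trans
    (cong₂ _+_ (count-inside-inside xs (suc k) U)
      (cong ([≥2] (suc Subset.∣ x ∣) *_) (take-cong x (count-inside-outside xs isEmpty k) U)))
    (+-comm (takeAny xs ([≥2] ∘ suc) (isEmpty k) U) _)

  -- Since `subsets` lists the sets without the first element first, the block of that element is
  -- chosen last. The exchange, again due to commuting removals, puts this choice first, so that the
  -- remaining blocks are counted by induction.
  count-addBlock : ∀ {n} (Ss xs : List (Subset n)) g k →
                   count xs (addBlock Ss g) k ≗ addBlock Ss (count xs g) k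
  count-addBlock Ss []       g zero          U = refl
  count-addBlock Ss []       g (suc k)       U = refl
  count-addBlock Ss (x ∷ xs) g zero          U = count-addBlock Ss xs g zero U
  -- Choosing x would use up the only block and leave none for the first element.
  count-addBlock Ss (x ∷ xs) g (suc zero)    U = trans
    (cong₂ _+_ (count-addBlock Ss xs g 1 U)
      (trans
        (cong ([≥2] Subset.∣ x ∣ *_) (trans (take-cong x (count-addBlock Ss xs g zero) U) (take-zero x U)))
        (*-zeroʳ ([≥2] Subset.∣ x ∣))))
    (+-identityʳ _)
  count-addBlock Ss (x ∷ xs) g (suc (suc k)) U = begin
    count xs (addBlock Ss g) (2 + k) U + [≥2] Subset.∣ x ∣ * take x (count xs (addBlock Ss g) (suc k)) U
      ≡⟨ cong₂ _+_ (count-addBlock Ss xs g (2 + k) U)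
          (cong ([≥2] Subset.∣ x ∣ *_) (take-cong x (count-addBlock Ss xs g (suc k)) U)) ⟩
    takeAny Ss ([≥2] ∘ suc) (count xs g (suc k)) U
      + [≥2] Subset.∣ x ∣ * take x (takeAny Ss ([≥2] ∘ suc) (count xs g k)) U
      ≡⟨ cong (_ +_) (takeAny-*take Ss ([≥2] ∘ suc) ([≥2] Subset.∣ x ∣) x (count xs g k) U) ⟨
    takeAny Ss ([≥2] ∘ suc) (count xs g (suc k)) U
      + takeAny Ss ([≥2] ∘ suc) (λ V → [≥2] Subset.∣ x ∣ * take x (count xs g k) V) U
      ≡⟨ takeAny-+ Ss ([≥2] ∘ suc) (count xs g (suc k)) _ U ⟨
    takeAny Ss ([≥2] ∘ suc) (count (x ∷ xs) g (suc k)) U ∎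

  -- The count depends on U only through its size. If the first element lies outside U, no subset
  -- containing it fits; if it lies in U, splitting off its block reproduces the recursion of `F`.
  count-subsets : ∀ n k (U : Subset n) → count (subsets n) isEmpty k U ≡ F k Subset.∣ U ∣
  count-subsets zero    zero    []            = refl
  count-subsets zero    (suc k) []            = trans (cong (0 +_) (*-zeroʳ ([≥2] 0))) refl
  count-subsets (suc n) k       (outside ∷ U) = begin
    count (subsets (suc n)) isEmpty k (outside ∷ U)
      ≡⟨ count-++ (List.map (outside ∷_) (subsets n)) _ isEmpty k (outside ∷ U) ⟩
    count (List.map (outside ∷_) (subsets n)) (count (List.map (inside ∷_) (subsets n)) isEmpty) k (outside ∷ U)
      ≡⟨ count-outside (subsets n) _ k outside U ⟩
    count (subsets n) (λ j V → count (List.map (inside ∷_) (subsets n)) isEmpty j (outside ∷ V)) k U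
      ≡⟨ count-cong (subsets n) (count-inside-outside (subsets n) isEmpty) k U ⟩
    count (subsets n) isEmpty k U
      ≡⟨ count-subsets n k U ⟩
    F k Subset.∣ U ∣ ∎
  count-subsets (suc n) k       (inside ∷ U)  = begin
    count (subsets (suc n)) isEmpty k (inside ∷ U)
      ≡⟨ count-++ (List.map (outside ∷_) (subsets n)) _ isEmpty k (inside ∷ U) ⟩
    count (List.map (outside ∷_) (subsets n)) (count (List.map (inside ∷_) (subsets n)) isEmpty) k (inside ∷ U)
      ≡⟨ count-outside (subsets n) _ k inside U ⟩
    count (subsets n) (λ j V → count (List.map (inside ∷_) (subsets n)) isEmpty j (inside ∷ V)) k U
      ≡⟨ count-cong (subsets n) (count-inside-inside (subsets n)) k U ⟩
    count (subsets n) (addBlock (subsets n) isEmpty) k U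
      ≡⟨ count-addBlock (subsets n) (subsets n) isEmpty k U ⟩
    addBlock (subsets n) (count (subsets n) isEmpty) k U
      ≡⟨ last k ⟩
    F k (suc Subset.∣ U ∣) ∎
    where
    last : ∀ k → addBlock (subsets n) (count (subsets n) isEmpty) k U ≡ F k (suc Subset.∣ U ∣)
    last zero    = refl
    last (suc k) = trans (takeAny-cong (subsets n) _ (count-subsets n k) U)
      (takeAny-subsets ([≥2] ∘ suc) (F k) U)

  -- Families of subsets and their indicators

  indicator : ∀ {n} → List (Subset n) → ℕ → Subset n → ℕ
  indicator []       k       U = isEmpty k U
  indicator (B ∷ 𝓑) zero    U = 0
  indicator (B ∷ 𝓑) (suc k) U = [≥2] Subset.∣ B ∣ * take B (indicator 𝓑 k) U

  sumOver : ∀ {A : Set} → List A → (A → ℕ) → ℕ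
  sumOver []       f = 0
  sumOver (x ∷ xs) f = f x + sumOver xs f

  sumOver-++ : ∀ {A : Set} (xs ys : List A) f → sumOver (xs ++ ys) f ≡ sumOver xs f + sumOver ys f
  sumOver-++ []       ys f = refl
  sumOver-++ (x ∷ xs) ys f = trans (cong (f x +_) (sumOver-++ xs ys f)) (sym (+-assoc (f x) _ _))

  sumOver-map : ∀ {A B : Set} (h : A → B) xs f → sumOver (List.map h xs) f ≡ sumOver xs (f ∘ h)
  sumOver-map h []       f = refl
  sumOver-map h (x ∷ xs) f = cong (f (h x) +_) (sumOver-map h xs f)

  sumOver-zero : ∀ {A : Set} (xs : List A) → sumOver xs (λ _ → 0) ≡ 0
  sumOver-zero []       = refl
  sumOver-zero (x ∷ xs) = sumOver-zero xs

  sumOver-*take : ∀ {A : Set} {n} (xs : List A) c x (g : A → Subset n → ℕ) U →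
    sumOver xs (λ a → c * take x (g a) U) ≡ c * take x (λ V → sumOver xs (λ a → g a V)) U
  sumOver-*take []       c x g U = sym (trans (cong (c *_) (take-zero x U)) (*-zeroʳ c))
  sumOver-*take (a ∷ xs) c x g U = trans (cong (_ +_) (sumOver-*take xs c x g U))
    (trans (sym (*-distribˡ-+ c (take x (g a) U) _))
      (cong (c *_) (sym (take-+ x (g a) (λ V → sumOver xs (λ b → g b V)) U))))

  -- A sublist of `x ∷ xs` either omits x or begins with it, and these are the two summands of
  -- `count`; `indicator` is a product over blocks precisely so that the second factors through
  -- `take x`.
  sumOver-sublists : ∀ {n} (xs : List (Subset n)) k U →
    sumOver (sublists xs) (λ 𝓑 → indicator 𝓑 k U) ≡ count xs isEmpty k U
  sumOver-sublists []       k U = +-identityʳ _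
  sumOver-sublists (x ∷ xs) k U = trans
    (sumOver-++ (sublists xs) _ _)
    (trans (cong₂ _+_ (sumOver-sublists xs k U) (sumOver-map (x ∷_) (sublists xs) _)) (last k))
    where
    last : ∀ k → count xs isEmpty k U + sumOver (sublists xs) (λ 𝓑 → indicator (x ∷ 𝓑) k U)
                 ≡ count (x ∷ xs) isEmpty k U
    last zero    = trans (cong (count xs isEmpty 0 U +_) (sumOver-zero (sublists xs))) (+-identityʳ _)
    last (suc k) = cong (_ +_) (trans
      (sumOver-*take (sublists xs) ([≥2] Subset.∣ x ∣) x (λ 𝓑 → indicator 𝓑 k) U)
      (cong ([≥2] Subset.∣ x ∣ *_) (take-cong x (sumOver-sublists xs k) U)))

  length-filter : ∀ {A : Set} {P : A → Set} (P? : Decidable P) f →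
    (∀ a → P a → f a ≡ 1) → (∀ a → f a ≢ 0 → P a) → ∀ xs → length (filter P? xs) ≡ sumOver xs f
  length-filter P? f P⇒1 ≢0⇒P []       = refl
  length-filter P? f P⇒1 ≢0⇒P (x ∷ xs) with P? x
  ... | yes p = cong₂ _+_ (sym (P⇒1 x p)) (length-filter P? f P⇒1 ≢0⇒P xs)
  ... | no ¬p with f x in eq
  ...   | zero  = length-filter P? f P⇒1 ≢0⇒P xs
  ...   | suc _ = contradiction (≢0⇒P x λ fx≡0 → 0≢1+n (trans (sym fx≡0) eq)) ¬p

  -- Relative to U, so that deleting the first block leaves a partition of the same kind, of
  -- `U ─ B`. Nonemptiness of the blocks is implied by `large`.
  record Partitions {n} (U : Subset n) (k : ℕ) (𝓑 : List (Subset n)) : Set where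
    field
      within   : All (_⊆ U) 𝓑
      disjoint : AllPairs (λ B C → Empty (B ∩ C)) 𝓑
      covering : ∀ {i} → i ∈ U → Any (i ∈_) 𝓑
      size     : length 𝓑 ≡ k
      large    : All (λ B → 1 < Subset.∣ B ∣) 𝓑

  open Partitions

  x∈p─q⇒x∉q : ∀ {n} (p q : Subset n) {i} → i ∈ p ─ q → i ∉ q
  x∈p─q⇒x∉q (_ ∷ p) (outside ∷ q) (there i∈) (there i∈q) = x∈p─q⇒x∉q p q i∈ i∈q
  x∈p─q⇒x∉q (_ ∷ p) (inside ∷ q)  (there i∈) (there i∈q) = x∈p─q⇒x∉q p q i∈ i∈q

  within─ : ∀ {n} {U B : Subset n} {𝓑} →
            All (_⊆ U) 𝓑 → All (λ C → Empty (B ∩ C)) 𝓑 → All (_⊆ U ─ B) 𝓑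
  within─ []            []            = []
  within─ (C⊆U ∷ within) (B∩C ∷ disjoint) =
    (λ i∈C → x∈p∧x∉q⇒x∈p─q (C⊆U i∈C) λ i∈B → B∩C (_ , x∈p∩q⁺ (i∈B , i∈C))) ∷ within─ within disjoint

  Partitions-∷⁻ : ∀ {n} {U B : Subset n} {k 𝓑} → Partitions U (suc k) (B ∷ 𝓑) → Partitions (U ─ B) k 𝓑
  Partitions-∷⁻ {U = U} {B} {k} {𝓑} π with within π | disjoint π | large π
  ... | _ ∷ within𝓑 | disjointB ∷ disjoint𝓑 | _ ∷ large𝓑 = record
    { within   = within─ within𝓑 disjointB
    ; disjoint = disjoint𝓑
    ; covering = λ i∈ → Any.tail (x∈p─q⇒x∉q U B i∈) (covering π (p─q⊆p U B i∈))
    ; size     = suc-injective (size π)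
    ; large    = large𝓑
    }

  Partitions-∷⁺ : ∀ {n} {U B : Subset n} {k 𝓑} → B ⊆ U → 1 < Subset.∣ B ∣ →
                  Partitions (U ─ B) k 𝓑 → Partitions U (suc k) (B ∷ 𝓑)
  Partitions-∷⁺ {U = U} {B} {𝓑 = 𝓑} B⊆U 1<B π = record
    { within   = B⊆U ∷ All.map {P = _⊆ U ─ B} (λ C⊆ {_} → ⊆-trans C⊆ (p─q⊆p U B)) (within π)
    ; disjoint = All.map {P = _⊆ U ─ B} (λ { C⊆ (i , i∈B∩C) →
                   let i∈B , i∈C = x∈p∩q⁻ _ _ i∈B∩C in x∈p─q⇒x∉q U B (C⊆ i∈C) i∈B }) (within π)
                 ∷ disjoint π
    ; covering = cover
    ; size     = cong suc (size π)
    ; large    = 1<B ∷ large π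
    }
    where
    cover : ∀ {i} → i ∈ U → Any (i ∈_) (B ∷ 𝓑)
    cover {i} i∈U with i ∈? B
    ... | yes i∈B = here i∈B
    ... | no  i∉B = there (covering π (x∈p∧x∉q⇒x∈p─q i∈U i∉B))

  1<n⇒[≥2]≡1 : ∀ {n} → 1 < n → [≥2] n ≡ 1
  1<n⇒[≥2]≡1 (s≤s (s≤s _)) = refl

  [≥2]≢0⇒1<n : ∀ n → [≥2] n ≢ 0 → 1 < n
  [≥2]≢0⇒1<n 0             ≢0 = contradiction refl ≢0
  [≥2]≢0⇒1<n 1             ≢0 = contradiction refl ≢0
  [≥2]≢0⇒1<n (suc (suc n)) ≢0 = s≤s (s≤s z≤n)

  [0]≢0⇒∉ : ∀ {n} {p : Subset n} {i} → [0] Subset.∣ p ∣ ≢ 0 → i ∉ p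
  [0]≢0⇒∉ {p = outside ∷ p} ≢0 (there i∈p) = [0]≢0⇒∉ ≢0 i∈p
  [0]≢0⇒∉ {p = inside ∷ p}  ≢0 _ = contradiction refl ≢0

  ∉⇒[0]≡1 : ∀ {n} (p : Subset n) → (∀ {i} → i ∉ p) → [0] Subset.∣ p ∣ ≡ 1
  ∉⇒[0]≡1 {n} p ∉p rewrite Empty-unique {p = p} (λ (_ , i∈p) → ∉p i∈p) | ∣⊥∣≡0 n = refl

  Partitions⇒indicator≡1 : ∀ {n} 𝓑 {k} {U : Subset n} → Partitions U k 𝓑 → indicator 𝓑 k U ≡ 1
  Partitions⇒indicator≡1 []       {zero}  {U} π =
    trans (+-identityʳ _) (∉⇒[0]≡1 U λ i∈U → contradiction (covering π i∈U) λ ())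
  Partitions⇒indicator≡1 []       {suc k} π = contradiction (size π) 0≢1+n
  Partitions⇒indicator≡1 (B ∷ 𝓑) {zero}  π = contradiction (sym (size π)) 0≢1+n
  Partitions⇒indicator≡1 (B ∷ 𝓑) {suc k} {U} π = cong₂ _*_
    (1<n⇒[≥2]≡1 (All.head (large π)))
    (trans (take-⊆ B (indicator 𝓑 k) U (All.head (within π))) (Partitions⇒indicator≡1 𝓑 (Partitions-∷⁻ π)))

  indicator≢0⇒Partitions : ∀ {n} 𝓑 {k} {U : Subset n} → indicator 𝓑 k U ≢ 0 → Partitions U k 𝓑
  indicator≢0⇒Partitions []       {zero}  {U} ≢0 = record
    { within   = []
    ; disjoint = []
    ; covering = λ i∈U → contradiction i∈U ([0]≢0⇒∉ (≢0 ∘ trans (+-identityʳ _)))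
    ; size     = refl
    ; large    = []
    }
  indicator≢0⇒Partitions []       {suc k} ≢0 = contradiction refl ≢0
  indicator≢0⇒Partitions (B ∷ 𝓑) {zero}  ≢0 = contradiction refl ≢0
  indicator≢0⇒Partitions (B ∷ 𝓑) {suc k} {U} ≢0 = Partitions-∷⁺ B⊆U
    ([≥2]≢0⇒1<n _ λ e → ≢0 (cong (_* take B (indicator 𝓑 k) U) e))
    (indicator≢0⇒Partitions 𝓑 λ e → take≢0 (trans (take-⊆ B _ U B⊆U) e))
    where
    take≢0 : take B (indicator 𝓑 k) U ≢ 0
    take≢0 e = ≢0 (trans (cong ([≥2] Subset.∣ B ∣ *_) e) (*-zeroʳ ([≥2] Subset.∣ B ∣)))
    B⊆U = take≢0⇒⊆ B (indicator 𝓑 k) U take≢0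

  1<∣p∣⇒Nonempty : ∀ {n} (p : Subset n) → 1 < Subset.∣ p ∣ → Nonempty p
  1<∣p∣⇒Nonempty {n} p 1<∣p∣ with nonempty? p
  ... | yes ne = ne
  ... | no ¬ne with () ← subst (1 <_) (trans (cong Subset.∣_∣ (Empty-unique ¬ne)) (∣⊥∣≡0 n)) 1<∣p∣

  D≡F : ∀ n k → D n k ≡ F k n
  D≡F n k = begin
    D n k
      ≡⟨ length-filter (isPartitionWithoutSingletons? n k) (λ 𝓑 → indicator 𝓑 k ⊤)
          (λ 𝓑 (π , size𝓑 , large𝓑) → Partitions⇒indicator≡1 𝓑 (record
            { within   = All.universal {P = _⊆ ⊤} (λ _ {_} _ → ∈⊤) 𝓑
            ; disjoint = IsPartition.disjoint π
            ; covering = λ {i} _ → IsPartition.covering π i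
            ; size     = size𝓑
            ; large    = large𝓑 }))
          (λ 𝓑 ≢0 → let π = indicator≢0⇒Partitions 𝓑 ≢0 in
            mkIsPartition (All.map (λ {B} → 1<∣p∣⇒Nonempty B) (large π)) (disjoint π) (λ _ → covering π ∈⊤)
            , size π , large π)
          (families n) ⟩
    sumOver (sublists (subsets n)) (λ 𝓑 → indicator 𝓑 k ⊤)
      ≡⟨ sumOver-sublists (subsets n) k ⊤ ⟩
    count (subsets n) isEmpty k ⊤
      ≡⟨ count-subsets n k ⊤ ⟩
    F k Subset.∣ ⊤ {n} ∣
      ≡⟨ cong (F k) (∣⊤∣≡n n) ⟩
    F k n ∎

  -- Here k + 1 blocks of at least two elements each would require 2k + 2 elements.
  n<2k⇒F≡0 : ∀ k n → n ≤ suc (k * 2) → F (suc k) n ≡ 0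
  n<2k⇒F≡0 k       zero          _           = refl
  n<2k⇒F≡0 k       (suc zero)    _           = refl
  n<2k⇒F≡0 (suc k) (suc (suc n)) (s≤s (s≤s n≤)) = begin
    F (2 + k) (2 + n)
      ≡⟨ F-rec (suc k) n ⟩
    (2 + k) * F (2 + k) (suc n) + suc n * F (suc k) n
      ≡⟨ cong₂ (λ x y → (2 + k) * x + suc n * y)
          (n<2k⇒F≡0 (suc k) (suc n) (s≤s (m≤n⇒m≤1+n n≤))) (n<2k⇒F≡0 k n n≤) ⟩
    (2 + k) * 0 + suc n * 0
      ≡⟨ cong₂ _+_ (*-zeroʳ (2 + k)) (*-zeroʳ (suc n)) ⟩
    0 ∎
  n<2k⇒F≡0 zero    (suc (suc n)) (s≤s ())

  -- Closed forms near the diagonal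

  -- By D≡F, G j k = D(2k + j, k).
  G : ℕ → ℕ → ℕ
  G j k = F k (k * 2 + j)

  -- The other term of the recurrence lies beyond the diagonal and vanishes. What remains counts
  -- perfect matchings: a given element of 2k + 2 has 2k + 1 possible partners.
  G-rec-zero : ∀ k → G 0 (suc k) ≡ suc (k * 2) * G 0 k
  G-rec-zero k = begin
    F (suc k) (2 + (k * 2 + 0))
      ≡⟨ F-rec k (k * 2 + 0) ⟩
    suc k * F (suc k) (suc (k * 2 + 0)) + suc (k * 2 + 0) * G 0 k
      ≡⟨ cong₂ (λ x y → suc k * x + suc y * G 0 k)
          (n<2k⇒F≡0 k _ (s≤s (≤-reflexive (+-identityʳ (k * 2))))) (+-identityʳ (k * 2)) ⟩
    suc k * 0 + suc (k * 2) * G 0 k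
      ≡⟨ cong (_+ suc (k * 2) * G 0 k) (*-zeroʳ (suc k)) ⟩
    suc (k * 2) * G 0 k ∎

  G-rec-suc : ∀ j k → G (suc j) (suc k) ≡ suc k * G j (suc k) + (k * 2 + 2 + j) * G (suc j) k
  G-rec-suc j k = trans (F-rec k (k * 2 + suc j)) (cong₂ _+_
    (cong (λ n → suc k * F (suc k) (suc n)) (+-suc (k * 2) j))
    (cong (_* G (suc j) k) (lemma k j)))
    where
    lemma : ∀ k j → suc (k * 2 + suc j) ≡ k * 2 + 2 + j
    lemma = solve-∀

  -- oddFactorial m = (2m − 1)!!
  oddFactorial : ℕ → ℕ
  oddFactorial zero    = 1
  oddFactorial (suc m) = suc (m * 2) * oddFactorial m

  -- The numerals m * c and suc j are variables, because Agda would otherwise compare large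
  -- multiples by unfolding them.
  G-step : ∀ c m c′ j j′ k {X Y} → m * c ≡ c′ → suc j ≡ j′ →
           c * G j (suc k) ≡ X → c′ * G j′ k ≡ Y →
           c′ * G j′ (suc k) ≡ suc k * (m * X) + (k * 2 + 2 + j) * Y
  G-step c m _ j _ k refl refl refl refl = trans (cong ((m * c) *_) (G-rec-suc j k))
    (lemma c m (suc k) (G j (suc k)) (k * 2 + 2 + j) (G (suc j) k))
    where
    lemma : ∀ c m a g b h → (m * c) * (a * g + b * h) ≡ a * (m * (c * g)) + b * ((m * c) * h)
    lemma = solve-∀

  -- For each fixed j, `G j` is a rational polynomial times an odd double factorial. The index of
  -- the latter is chosen so that `G 0 d`, `G 2 (d−1)`, `G 4 (d−2)` share one double factorial, and
  -- `G 1 d`, `G 3 (d−1)`, `G 5 (d−2)` another; it cancels in the ratios. Each form follows by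
  -- induction on k from that for j - 1.
  G0 : ∀ k → G 0 k ≡ oddFactorial k
  G0 zero    = refl
  G0 (suc k) = trans (G-rec-zero k) (cong (suc (k * 2) *_) (G0 k))

  G1 : ∀ k → 3 * G 1 k ≡ k * oddFactorial (suc k)
  G1 zero    = refl
  G1 (suc k) = trans (G-step 1 3 3 0 1 k refl refl (cong (1 *_) (G0 (suc k))) (G1 k)) (lemma k (oddFactorial (suc k)))
    where
    lemma : ∀ k x → suc k * (3 * (1 * x)) + (k * 2 + 2 + 0) * (k * x) ≡ suc k * (suc (suc k * 2) * x)
    lemma = solve-∀

  G2 : ∀ k → 18 * G 2 k ≡ k * suc k * suc (k * 2) * oddFactorial (suc k)
  G2 zero    = refl
  G2 (suc k) = trans (G-step 3 6 18 1 2 k refl refl (G1 (suc k)) (G2 k)) (lemma k (oddFactorial (suc k)))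
    where
    lemma : ∀ k x → let y = suc (suc k * 2) * x in
      suc k * (6 * (suc k * y)) + (k * 2 + 2 + 1) * (k * suc k * suc (k * 2) * x)
        ≡ suc k * suc (suc k) * suc (suc k * 2) * y
    lemma = solve-∀

  G3 : ∀ k → 810 * G 3 k ≡ k * suc k * (10 * (k * k) + 15 * k + 2) * oddFactorial (suc (suc k))
  G3 zero    = refl
  G3 (suc k) = trans (G-step 18 45 810 2 3 k refl refl (G2 (suc k)) (G3 k)) (lemma k (oddFactorial (suc (suc k))))
    where
    lemma : ∀ k x →
      suc k * (45 * (suc k * suc (suc k) * suc (suc k * 2) * x))
        + (k * 2 + 2 + 2) * (k * suc k * (10 * (k * k) + 15 * k + 2) * x)
        ≡ suc k * suc (suc k) * (10 * (suc k * suc k) + 15 * suc k + 2) * (suc (suc (suc k) * 2) * x)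
    lemma = solve-∀

  -- Found by interpolation; the shift k = suc i makes all coefficients nonnegative.
  P₄ P₅ : ℕ → ℕ
  P₄ i = ((20 * i + 120) * i + 211) * i + 108
  P₅ i = (((28 * i + 252) * i + 749) * i + 861) * i + 324

  G4 : ∀ i → 9720 * G 4 (suc i) ≡ (1 + i) * (2 + i) * (3 + i) * P₄ i * oddFactorial (suc (suc (suc i)))
  G4 zero    = refl
  G4 (suc i) = trans (G-step 810 12 9720 3 4 (suc i) refl refl (G3 (suc (suc i))) (G4 i))
    (lemma i (oddFactorial (suc (suc (suc i)))))
    where
    lemma : ∀ i x → let k = suc (suc i) ; y = suc (suc (suc (suc i)) * 2) * x in
      k * (12 * (k * suc k * (10 * (k * k) + 15 * k + 2) * y))
        + (suc i * 2 + 2 + 3) * ((1 + i) * (2 + i) * (3 + i) * (((20 * i + 120) * i + 211) * i + 108) * x)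
        ≡ (1 + suc i) * (2 + suc i) * (3 + suc i) * (((20 * suc i + 120) * suc i + 211) * suc i + 108) * y
    lemma = solve-∀

  G5 : ∀ i → 204120 * G 5 (suc i) ≡ (1 + i) * (2 + i) * (3 + i) * P₅ i * oddFactorial (suc (suc (suc (suc i))))
  G5 zero    = refl
  G5 (suc i) = trans (G-step 9720 21 204120 4 5 (suc i) refl refl (G4 (suc i)) (G5 i))
    (lemma i (oddFactorial (suc (suc (suc (suc i))))))
    where
    lemma : ∀ i x → let k = suc (suc i) ; y = suc (suc (suc (suc (suc i))) * 2) * x in
      k * (21 * ((1 + suc i) * (2 + suc i) * (3 + suc i) * (((20 * suc i + 120) * suc i + 211) * suc i + 108) * x))
        + (suc i * 2 + 2 + 4) * ((1 + i) * (2 + i) * (3 + i) * ((((28 * i + 252) * i + 749) * i + 861) * i + 324) * x)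
        ≡ (1 + suc i) * (2 + suc i) * (3 + suc i)
          * ((((28 * suc i + 252) * suc i + 749) * suc i + 861) * suc i + 324) * y
    lemma = solve-∀

-- Rational estimates, square roots and limits

module Approximation where

  import Defs as Real
  open import Defs using (_÷_; √; seq; sqrtNumerator; sqrtNumerator-lower; sqrtNumerator-upper; inverse-or-0; inverse-or-0-inverse; 0<δ≤∣q∣⇒q≢0)
  open import Data.Integer.Base as ℤ using (+_; -[1+_])
  import Data.Integer.Properties as ℤ
  import Data.Integer.Tactic.RingSolver as ℤ-Solver
  open import Data.Nat.Base as ℕ using (ℕ; zero; suc; s≤s; z≤n)
  import Data.Nat.Properties as ℕ
  open import Data.Product.Base using (∃; _,_; proj₁; proj₂)
  open import Data.Rational.Base hiding (_÷_)
  open import Data.Rational.Properties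
  import Data.Rational.Unnormalised.Base as ℚᵘ
  import Data.Rational.Unnormalised.Properties as ℚᵘ
  open import Data.Sum.Base using (inj₁; inj₂)
  open import Level using (0ℓ)
  open import Relation.Binary.PropositionalEquality
  open import Relation.Nullary using (yes; no; contradiction)
  open import Relation.Nullary.Decidable using (dec⇒maybe)
  open import Tactic.RingSolver using (solve-∀)
  open import Tactic.RingSolver.Core.AlmostCommutativeRing using (AlmostCommutativeRing; fromCommutativeRing)

  ℚ-ring : AlmostCommutativeRing 0ℓ 0ℓ
  ℚ-ring = fromCommutativeRing +-*-commutativeRing λ x → dec⇒maybe (0ℚ ≟ x)

  0≤-⇒≤ : ∀ {p q} → 0ℚ ≤ q - p → p ≤ q
  0≤-⇒≤ {p} {q} h = subst₂ _≤_ (+-identityˡ p) (lemma p q) (+-monoˡ-≤ p h)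
    where
    lemma : ∀ p q → q - p + p ≡ q
    lemma = solve-∀ ℚ-ring

  ≤⇒0≤- : ∀ {p q} → p ≤ q → 0ℚ ≤ q - p
  ≤⇒0≤- {p} {q} h = subst (_≤ q - p) (+-inverseʳ p) (+-monoˡ-≤ (- p) h)

  0≤+ : ∀ {p q} → 0ℚ ≤ p → 0ℚ ≤ q → 0ℚ ≤ p + q
  0≤+ {p} {q} 0≤p 0≤q = +-mono-≤ 0≤p 0≤q

  0≤* : ∀ {p q} → 0ℚ ≤ p → 0ℚ ≤ q → 0ℚ ≤ p * q
  0≤* {p} {q} 0≤p 0≤q = nonNegative⁻¹ (p * q)
    {{nonNeg*nonNeg⇒nonNeg p {{nonNegative 0≤p}} q {{nonNegative 0≤q}}}}

  0≤1 : 0ℚ ≤ 1ℚ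
  0≤1 = nonNegative⁻¹ 1ℚ

  *-mono-≤-nonNeg : ∀ {p q r s} → 0ℚ ≤ r → 0ℚ ≤ q → p ≤ q → r ≤ s → p * r ≤ q * s
  *-mono-≤-nonNeg {p} {q} {r} {s} 0≤r 0≤q p≤q r≤s = ≤-trans
    (*-monoʳ-≤-nonNeg r {{nonNegative 0≤r}} p≤q)
    (*-monoˡ-≤-nonNeg q {{nonNegative 0≤q}} r≤s)

  square-cancel-≤ : ∀ {p q} → 0ℚ ≤ q → p * p ≤ q * q → p ≤ q
  square-cancel-≤ {p} {q} 0≤q h with p ≤? q
  ... | yes p≤q = p≤q
  ... | no  p≰q = contradiction (<-≤-trans (≤-<-trans
    (*-monoˡ-≤-nonNeg q {{nonNegative 0≤q}} (<⇒≤ q<p))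
    (*-monoˡ-<-pos p {{positive (≤-<-trans 0≤q q<p)}} q<p)) h) (<-irrefl refl)
    where q<p = ≰⇒> p≰q

  p≤∣p∣ : ∀ p → p ≤ ∣ p ∣
  p≤∣p∣ p with ≤-total 0ℚ p
  ... | inj₁ 0≤p = ≤-reflexive (sym (0≤p⇒∣p∣≡p 0≤p))
  ... | inj₂ p≤0 = ≤-trans p≤0 (0≤∣p∣ p)

  ∣p∣≤q⁺ : ∀ {p q} → p ≤ q → - p ≤ q → ∣ p ∣ ≤ q
  ∣p∣≤q⁺ {p} {q} p≤q -p≤q with ∣p∣≡p∨∣p∣≡-p p
  ... | inj₁ e = subst (_≤ q) (sym e) p≤q
  ... | inj₂ e = subst (_≤ q) (sym e) -p≤q

  ∣p∣≤q⁻ˡ : ∀ {p q} → ∣ p ∣ ≤ q → p ≤ q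
  ∣p∣≤q⁻ˡ {p} h = ≤-trans (p≤∣p∣ p) h

  ∣p∣≤q⁻ʳ : ∀ {p q} → ∣ p ∣ ≤ q → - p ≤ q
  ∣p∣≤q⁻ʳ {p} h = ≤-trans (p≤∣p∣ (- p)) (≤-trans (≤-reflexive (∣-p∣≡∣p∣ p)) h)

  ι : ℕ → ℚ
  ι n = + n / 1

  toℚᵘ-÷ : ∀ a b → toℚᵘ (a ÷ suc b) ℚᵘ.≃ ℚᵘ.mkℚᵘ (+ a) b
  toℚᵘ-÷ a b = toℚᵘ-fromℚᵘ (ℚᵘ.mkℚᵘ (+ a) b)

  ι-+ : ∀ m n → ι (m ℕ.+ n) ≡ ι m + ι n
  ι-+ m n = toℚᵘ-injective (ℚᵘ.≃-trans (toℚᵘ-÷ (m ℕ.+ n) 0) (ℚᵘ.≃-trans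
    (ℚᵘ.*≡* (trans (cong (ℤ._* + 1) (ℤ.pos-+ m n)) (lemma (+ m) (+ n))))
    (ℚᵘ.≃-sym (ℚᵘ.≃-trans (toℚᵘ-homo-+ (ι m) (ι n)) (ℚᵘ.+-cong (toℚᵘ-÷ m 0) (toℚᵘ-÷ n 0))))))
    where
    lemma : ∀ m n → (m ℤ.+ n) ℤ.* + 1 ≡ (m ℤ.* + 1 ℤ.+ n ℤ.* + 1) ℤ.* + 1
    lemma = ℤ-Solver.solve-∀

  ι-* : ∀ m n → ι (m ℕ.* n) ≡ ι m * ι n
  ι-* m n = toℚᵘ-injective (ℚᵘ.≃-trans (toℚᵘ-÷ (m ℕ.* n) 0) (ℚᵘ.≃-trans
    (ℚᵘ.*≡* (cong (ℤ._* + 1) (ℤ.pos-* m n)))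
    (ℚᵘ.≃-sym (ℚᵘ.≃-trans (toℚᵘ-homo-* (ι m) (ι n)) (ℚᵘ.*-cong (toℚᵘ-÷ m 0) (toℚᵘ-÷ n 0))))))

  ι*÷ : ∀ a b → ι (suc b) * (a ÷ suc b) ≡ ι a
  ι*÷ a b = toℚᵘ-injective (ℚᵘ.≃-trans
    (ℚᵘ.≃-trans (toℚᵘ-homo-* (ι (suc b)) (a ÷ suc b)) (ℚᵘ.*-cong (toℚᵘ-÷ (suc b) 0) (toℚᵘ-÷ a b)))
    (ℚᵘ.≃-trans
      (ℚᵘ.*≡* (trans (lemma (+ suc b) (+ a)) (cong (λ n → + a ℤ.* + n) (sym (ℕ.*-identityˡ (suc b))))))
      (ℚᵘ.≃-sym (toℚᵘ-÷ a 0))))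
    where
    lemma : ∀ b a → b ℤ.* a ℤ.* + 1 ≡ a ℤ.* b
    lemma = ℤ-Solver.solve-∀

  0≤÷ : ∀ a b → 0ℚ ≤ a ÷ b
  0≤÷ a zero    = ≤-refl
  0≤÷ a (suc b) = nonNegative⁻¹ _ {{normalize-nonNeg a (suc b)}}

  0≤ι : ∀ n → 0ℚ ≤ ι n
  0≤ι n = 0≤÷ n 1

  ι-mono-≤ : ∀ {m n} → m ℕ.≤ n → ι m ≤ ι n
  ι-mono-≤ {m} {n} m≤n = 0≤-⇒≤ (subst (0ℚ ≤_) eq (0≤ι (n ℕ.∸ m)))
    where
    lemma : ∀ x y → y ≡ x + y - x
    lemma = solve-∀ ℚ-ring
    eq : ι (n ℕ.∸ m) ≡ ι n - ι m
    eq = trans (lemma (ι m) (ι (n ℕ.∸ m)))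
      (cong (_- ι m) (trans (sym (ι-+ m (n ℕ.∸ m))) (cong ι (ℕ.m+[n∸m]≡n m≤n))))

  1≤ι-suc : ∀ n → 1ℚ ≤ ι (suc n)
  1≤ι-suc n = ι-mono-≤ {1} {suc n} (s≤s z≤n)

  0<ι-suc : ∀ n → 0ℚ < ι (suc n)
  0<ι-suc n = <-≤-trans (positive⁻¹ 1ℚ) (1≤ι-suc n)

  *-cancelˡ-ι : ∀ b {p q} → ι (suc b) * p ≡ ι (suc b) * q → p ≡ q
  *-cancelˡ-ι b {p} {q} e = trans (inv p) (trans (cong ((1 ÷ suc b) *_) e) (sym (inv q)))
    where
    lemma : ∀ x y z → x * y ≡ 1ℚ → z ≡ y * (x * z)
    lemma x y z xy≡1 = trans (sym (*-identityˡ z)) (trans (cong (_* z) (sym xy≡1)) (assoc x y z))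
      where
      assoc : ∀ x y z → x * y * z ≡ y * (x * z)
      assoc = solve-∀ ℚ-ring
    inv : ∀ z → z ≡ (1 ÷ suc b) * (ι (suc b) * z)
    inv z = lemma (ι (suc b)) (1 ÷ suc b) z (ι*÷ 1 b)

  ÷-cross : ∀ a b p q → a ℕ.* suc q ≡ p ℕ.* suc b → a ÷ suc b ≡ p ÷ suc q
  ÷-cross a b p q e = *-cancelˡ-ι b (*-cancelˡ-ι q (begin
    ι (suc q) * (ι (suc b) * (a ÷ suc b)) ≡⟨ cong (ι (suc q) *_) (ι*÷ a b) ⟩
    ι (suc q) * ι a                       ≡⟨ *-comm (ι (suc q)) (ι a) ⟩
    ι a * ι (suc q)                       ≡⟨ ι-* a (suc q) ⟨
    ι (a ℕ.* suc q)                       ≡⟨ cong ι e ⟩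
    ι (p ℕ.* suc b)                       ≡⟨ ι-* p (suc b) ⟩
    ι p * ι (suc b)                       ≡⟨ cong (_* ι (suc b)) (ι*÷ p q) ⟨
    ι (suc q) * (p ÷ suc q) * ι (suc b)   ≡⟨ lemma (ι (suc q)) (p ÷ suc q) (ι (suc b)) ⟩
    ι (suc q) * (ι (suc b) * (p ÷ suc q)) ∎))
    where
    open ≡-Reasoning
    lemma : ∀ x y z → x * y * z ≡ x * (z * y)
    lemma = solve-∀ ℚ-ring

  ÷≡ι* : ∀ a b → a ÷ suc b ≡ ι a * (1 ÷ suc b)
  ÷≡ι* a b = *-cancelˡ-ι b (trans (ι*÷ a b) (sym (begin
    ι (suc b) * (ι a * (1 ÷ suc b)) ≡⟨ lemma (ι (suc b)) (ι a) (1 ÷ suc b) ⟩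
    ι a * (ι (suc b) * (1 ÷ suc b)) ≡⟨ cong (ι a *_) (ι*÷ 1 b) ⟩
    ι a * 1ℚ                        ≡⟨ *-identityʳ (ι a) ⟩
    ι a                             ∎)))
    where
    open ≡-Reasoning
    lemma : ∀ x y z → x * (y * z) ≡ y * (x * z)
    lemma = solve-∀ ℚ-ring

  -- Square roots

  ≤-cancel-ι : ∀ b {p q} → ι (suc b) * p ≤ ι (suc b) * q → p ≤ q
  ≤-cancel-ι b = *-cancelˡ-≤-pos (ι (suc b)) {{positive (0<ι-suc b)}}

  -- Multiplication by (d+1)(m+1)² turns a comparison of (s/(m+1))² with a/(d+1) into the inequality
  -- of naturals that characterises `sqrtNumerator`.
  ι-clear : ∀ s m d → ι (suc d) * (ι (suc m) * (ι (suc m) * ((s ÷ suc m) * (s ÷ suc m)))) ≡ ι (s ℕ.* s ℕ.* suc d)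
  ι-clear s m d = begin
    ι (suc d) * (ι (suc m) * (ι (suc m) * ((s ÷ suc m) * (s ÷ suc m))))
      ≡⟨ lemma (ι (suc d)) (ι (suc m)) (s ÷ suc m) ⟩
    (ι (suc m) * (s ÷ suc m)) * (ι (suc m) * (s ÷ suc m)) * ι (suc d)
      ≡⟨ cong (λ x → x * x * ι (suc d)) (ι*÷ s m) ⟩
    ι s * ι s * ι (suc d)
      ≡⟨ cong (_* ι (suc d)) (ι-* s s) ⟨
    ι (s ℕ.* s) * ι (suc d)
      ≡⟨ ι-* (s ℕ.* s) (suc d) ⟨
    ι (s ℕ.* s ℕ.* suc d) ∎
    where
    open ≡-Reasoning
    lemma : ∀ d m x → d * (m * (m * (x * x))) ≡ (m * x) * (m * x) * d
    lemma = solve-∀ ℚ-ring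

  ι-clear-÷ : ∀ a m d → ι (suc d) * (ι (suc m) * (ι (suc m) * (a ÷ suc d))) ≡ ι (a ℕ.* (suc m ℕ.* suc m))
  ι-clear-÷ a m d = begin
    ι (suc d) * (ι (suc m) * (ι (suc m) * (a ÷ suc d)))
      ≡⟨ lemma (ι (suc d)) (ι (suc m)) (a ÷ suc d) ⟩
    (ι (suc d) * (a ÷ suc d)) * (ι (suc m) * ι (suc m))
      ≡⟨ cong₂ _*_ (ι*÷ a d) (sym (ι-* (suc m) (suc m))) ⟩
    ι a * ι (suc m ℕ.* suc m)
      ≡⟨ ι-* a (suc m ℕ.* suc m) ⟨
    ι (a ℕ.* (suc m ℕ.* suc m)) ∎
    where
    open ≡-Reasoning
    lemma : ∀ d m x → d * (m * (m * x)) ≡ (d * x) * (m * m)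
    lemma = solve-∀ ℚ-ring

  √-lower : ∀ q → 0ℚ ≤ q → ∀ m →
    let s = sqrtNumerator q m ÷ suc m in s * s ≤ q
  √-lower q@(mkℚ (+ a) d c) _ m = subst (s ÷ suc m * (s ÷ suc m) ≤_) (↥p/↧p≡p q)
    (≤-cancel-ι m (≤-cancel-ι m (≤-cancel-ι d (subst₂ _≤_
      (sym (ι-clear s m d)) (sym (ι-clear-÷ a m d)) (ι-mono-≤ (sqrtNumerator-lower q m))))))
    where s = sqrtNumerator q m
  √-lower (mkℚ -[1+ _ ] _ _) (*≤* ()) m

  √-upper : ∀ q → 0ℚ ≤ q → ∀ m →
    let s = sqrtNumerator q m ÷ suc m + 1 ÷ suc m in q ≤ s * s
  √-upper q@(mkℚ (+ a) d c) _ m = subst₂ (λ x y → x ≤ y * y) (↥p/↧p≡p q) suc-÷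
    (≤-cancel-ι m (≤-cancel-ι m (≤-cancel-ι d (subst₂ _≤_
      (sym (ι-clear-÷ a m d)) (sym (ι-clear (suc s) m d)) (ι-mono-≤ (ℕ.<⇒≤ (sqrtNumerator-upper q m)))))))
    where
    s = sqrtNumerator q m
    suc-÷ : suc s ÷ suc m ≡ s ÷ suc m + 1 ÷ suc m
    suc-÷ = begin
      suc s ÷ suc m                     ≡⟨ ÷≡ι* (suc s) m ⟩
      ι (suc s) * (1 ÷ suc m)           ≡⟨ cong (_* (1 ÷ suc m)) (trans (cong ι (ℕ.+-comm 1 s)) (ι-+ s 1)) ⟩
      (ι s + 1ℚ) * (1 ÷ suc m)          ≡⟨ lemma (ι s) (1 ÷ suc m) ⟩
      ι s * (1 ÷ suc m) + (1 ÷ suc m)   ≡⟨ cong (_+ (1 ÷ suc m)) (÷≡ι* s m) ⟨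
      s ÷ suc m + 1 ÷ suc m             ∎
      where
      open ≡-Reasoning
      lemma : ∀ x y → (x + 1ℚ) * y ≡ x * y + y
      lemma = solve-∀ ℚ-ring
  √-upper (mkℚ -[1+ _ ] _ _) (*≤* ()) m

  archimedean : ∀ x → 0ℚ ≤ x → ∃ λ N → x ≤ ι N
  -- A nonnegative fraction is at most its numerator.
  archimedean x@(mkℚ (+ a) d c) 0≤x = a , (begin
    x                     ≡⟨ *-identityˡ x ⟨
    1ℚ * x                ≤⟨ *-monoʳ-≤-nonNeg x {{nonNegative 0≤x}} (1≤ι-suc d) ⟩
    ι (suc d) * x         ≡⟨ cong (ι (suc d) *_) (↥p/↧p≡p x) ⟨
    ι (suc d) * (a ÷ suc d) ≡⟨ ι*÷ a d ⟩
    ι a                   ∎)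
    where open ≤-Reasoning
  archimedean (mkℚ -[1+ _ ] _ _) (*≤* ())

  eventually-small : ∀ K → 0ℚ ≤ K → ∀ ε → 0ℚ < ε → ∃ λ N → ∀ m → N ℕ.≤ m → K * (1 ÷ suc m) ≤ ε
  eventually-small K 0≤K ε 0<ε = N , λ m N≤m → ≤-cancel-ι m (begin
    ι (suc m) * (K * (1 ÷ suc m)) ≡⟨ lemma₁ (ι (suc m)) K (1 ÷ suc m) ⟩
    K * (ι (suc m) * (1 ÷ suc m)) ≡⟨ cong (K *_) (trans (ι*÷ 1 m) (sym (*-inverseʳ ε))) ⟩
    K * (ε * 1/ ε)                ≡⟨ lemma₂ K ε (1/ ε) ⟩
    K * 1/ ε * ε                  ≤⟨ *-monoʳ-≤-nonNeg ε {{nonNegative (<⇒≤ 0<ε)}}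
                                       (≤-trans (proj₂ bound) (ι-mono-≤ (ℕ.≤-trans N≤m (ℕ.n≤1+n m)))) ⟩
    ι (suc m) * ε                 ∎)
    where
    open ≤-Reasoning
    instance
      ε⁺ = positive 0<ε
      ε≢0 = pos⇒nonZero ε
    bound = archimedean (K * 1/ ε) (0≤* 0≤K (<⇒≤ (positive⁻¹ (1/ ε) {{1/pos⇒pos ε}})))
    N = proj₁ bound
    lemma₁ : ∀ x y z → x * (y * z) ≡ y * (x * z)
    lemma₁ = solve-∀ ℚ-ring
    lemma₂ : ∀ x y z → x * (y * z) ≡ x * z * y
    lemma₂ = solve-∀ ℚ-ring

  -- Limits at rate 1/d, where d = 3 + e

  r : ℕ → ℚ
  r e = 1 ÷ suc (2 ℕ.+ e)

  ιr≡1 : ∀ e → ι (3 ℕ.+ e) * r e ≡ 1ℚ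
  ιr≡1 e = ι*÷ 1 (2 ℕ.+ e)

  0≤r : ∀ e → 0ℚ ≤ r e
  0≤r e = 0≤÷ 1 (3 ℕ.+ e)

  1÷≤1 : ∀ b → 1 ÷ suc b ≤ 1ℚ
  1÷≤1 b = ≤-cancel-ι b (≤-trans (≤-reflexive (ι*÷ 1 b))
    (≤-trans (1≤ι-suc b) (≤-reflexive (sym (*-identityʳ (ι (suc b)))))))

  r≤1 : ∀ e → r e ≤ 1ℚ
  r≤1 e = 1÷≤1 (2 ℕ.+ e)

  -- Convergence with error O(1/d), valid for every e. Sums and products then only combine the
  -- rates, and an index N is chosen once, in `⟶-eventually`.
  infix 4 _⟶_
  record _⟶_ (u : ℕ → ℚ) (a : ℚ) : Set where
    constructor mk⟶
    field
      rate    : ℚ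
      0≤rate  : 0ℚ ≤ rate
      bounded : ∀ e → ∣ u e - a ∣ ≤ rate * r e

  ⟶-eventually : ∀ {u a} → u ⟶ a → ∀ ε → 0ℚ < ε → ∃ λ N → ∀ e → N ℕ.≤ e → ∣ u e - a ∣ ≤ ε
  ⟶-eventually (mk⟶ C 0≤C h) ε 0<ε = proj₁ small , λ e N≤e →
    ≤-trans (h e) (proj₂ small (2 ℕ.+ e) (ℕ.≤-trans N≤e (ℕ.m≤n+m e 2)))
    where small = eventually-small C 0≤C ε 0<ε

  ⟶-cong : ∀ {u v a b} → u ≗ v → a ≡ b → u ⟶ a → v ⟶ b
  ⟶-cong u≗v refl (mk⟶ C 0≤C h) = mk⟶ C 0≤C λ e → subst (λ x → ∣ x - _ ∣ ≤ C * r e) (u≗v e) (h e)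

  ⟶-const : ∀ a → (λ _ → a) ⟶ a
  ⟶-const a = mk⟶ 0ℚ ≤-refl λ e →
    ≤-reflexive (trans (cong ∣_∣ (+-inverseʳ a)) (sym (*-zeroˡ (r e))))

  ⟶-null : ∀ {u} → (∀ e → 0ℚ ≤ u e) → (∀ e → u e ≤ r e) → u ⟶ 0ℚ
  ⟶-null {u} 0≤u u≤r = mk⟶ 1ℚ 0≤1 λ e → ≤-trans
    (≤-reflexive (trans (cong ∣_∣ (+-identityʳ (u e))) (0≤p⇒∣p∣≡p (0≤u e))))
    (≤-trans (u≤r e) (≤-reflexive (sym (*-identityˡ (r e)))))

  ⟶-+ : ∀ {u v a b} → u ⟶ a → v ⟶ b → (λ e → u e + v e) ⟶ a + b
  ⟶-+ {u} {v} {a} {b} (mk⟶ C 0≤C U) (mk⟶ K 0≤K V) = mk⟶ (C + K) (0≤+ 0≤C 0≤K) λ e → begin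
    ∣ u e + v e - (a + b) ∣       ≡⟨ cong ∣_∣ (lemma (u e) (v e) a b) ⟩
    ∣ u e - a + (v e - b) ∣       ≤⟨ ∣p+q∣≤∣p∣+∣q∣ (u e - a) (v e - b) ⟩
    ∣ u e - a ∣ + ∣ v e - b ∣     ≤⟨ +-mono-≤ (U e) (V e) ⟩
    C * r e + K * r e             ≡⟨ *-distribʳ-+ (r e) C K ⟨
    (C + K) * r e                 ∎
    where
    open ≤-Reasoning
    lemma : ∀ u v a b → u + v - (a + b) ≡ u - a + (v - b)
    lemma = solve-∀ ℚ-ring

  ⟶-* : ∀ {u v a b} → u ⟶ a → v ⟶ b → (λ e → u e * v e) ⟶ a * b
  ⟶-* {u} {v} {a} {b} (mk⟶ C 0≤C U) (mk⟶ K 0≤K V) =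
    mk⟶ ((C + ∣ a ∣) * K + ∣ b ∣ * C) (0≤+ (0≤* 0≤C+a 0≤K) (0≤* (0≤∣p∣ b) 0≤C)) λ e → begin
    ∣ u e * v e - a * b ∣
      ≡⟨ cong ∣_∣ (lemma₁ (u e) (v e) a b) ⟩
    ∣ u e * (v e - b) + b * (u e - a) ∣
      ≤⟨ ∣p+q∣≤∣p∣+∣q∣ (u e * (v e - b)) (b * (u e - a)) ⟩
    ∣ u e * (v e - b) ∣ + ∣ b * (u e - a) ∣
      ≡⟨ cong₂ _+_ (∣p*q∣≡∣p∣*∣q∣ (u e) (v e - b)) (∣p*q∣≡∣p∣*∣q∣ b (u e - a)) ⟩
    ∣ u e ∣ * ∣ v e - b ∣ + ∣ b ∣ * ∣ u e - a ∣
      ≤⟨ +-mono-≤ (*-mono-≤-nonNeg (0≤∣p∣ (v e - b)) 0≤C+a (bound e) (V e))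
          (*-monoˡ-≤-nonNeg ∣ b ∣ {{∣-∣-nonNeg b}} (U e)) ⟩
    (C + ∣ a ∣) * (K * r e) + ∣ b ∣ * (C * r e)
      ≡⟨ lemma₂ (C + ∣ a ∣) K ∣ b ∣ C (r e) ⟩
    ((C + ∣ a ∣) * K + ∣ b ∣ * C) * r e ∎
    where
    open ≤-Reasoning
    0≤C+a = 0≤+ 0≤C (0≤∣p∣ a)
    lemma₁ : ∀ u v a b → u * v - a * b ≡ u * (v - b) + b * (u - a)
    lemma₁ = solve-∀ ℚ-ring
    lemma₂ : ∀ x K b C r → x * (K * r) + b * (C * r) ≡ (x * K + b * C) * r
    lemma₂ = solve-∀ ℚ-ring
    lemma₃ : ∀ u a → u ≡ u - a + a
    lemma₃ = solve-∀ ℚ-ring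
    bound : ∀ e → ∣ u e ∣ ≤ C + ∣ a ∣
    bound e = begin
      ∣ u e ∣             ≡⟨ cong ∣_∣ (lemma₃ (u e) a) ⟩
      ∣ u e - a + a ∣     ≤⟨ ∣p+q∣≤∣p∣+∣q∣ (u e - a) a ⟩
      ∣ u e - a ∣ + ∣ a ∣ ≤⟨ +-monoˡ-≤ ∣ a ∣ (≤-trans (U e)
                              (≤-trans (*-monoˡ-≤-nonNeg C {{nonNegative 0≤C}} (r≤1 e))
                                (≤-reflexive (*-identityʳ C)))) ⟩
      C + ∣ a ∣           ∎

  r⟶0 : r ⟶ 0ℚ
  r⟶0 = ⟶-null 0≤r (λ _ → ≤-refl)

  infixr 8 _^_
  _^_ : ℚ → ℕ → ℚ
  x ^ zero  = 1ℚ
  x ^ suc m = x * x ^ m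

  ^-+ : ∀ x m n → x ^ (m ℕ.+ n) ≡ x ^ m * x ^ n
  ^-+ x zero    n = sym (*-identityˡ (x ^ n))
  ^-+ x (suc m) n = trans (cong (x *_) (^-+ x m n)) (sym (*-assoc x (x ^ m) (x ^ n)))

  -- The coefficient a of dᵐ may be 0: summands of lower degree are lifted by `grows-raise` to the
  -- common degree, where they contribute 0.
  record Grows (m : ℕ) (u : ℕ → ℕ) (a : ℚ) : Set where
    constructor mkGrows
    field
      limit : (λ e → ι (u e) * r e ^ m) ⟶ a

  grows-const : ∀ c → Grows 0 (λ _ → c) (ι c)
  grows-const c = mkGrows (⟶-cong (λ e → sym (*-identityʳ (ι c))) refl (⟶-const (ι c)))

  grows-+ : ∀ {m u v a b} → Grows m u a → Grows m v b → Grows m (λ e → u e ℕ.+ v e) (a + b)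
  grows-+ {m} {u} {v} (mkGrows U) (mkGrows V) = mkGrows (⟶-cong
    (λ e → trans (sym (*-distribʳ-+ (r e ^ m) (ι (u e)) (ι (v e)))) (cong (_* r e ^ m) (sym (ι-+ (u e) (v e)))))
    refl (⟶-+ U V))

  grows-* : ∀ {m n u v a b} → Grows m u a → Grows n v b → Grows (m ℕ.+ n) (λ e → u e ℕ.* v e) (a * b)
  grows-* {m} {n} {u} {v} (mkGrows U) (mkGrows V) = mkGrows (⟶-cong
    (λ e → trans (lemma (ι (u e)) (r e ^ m) (ι (v e)) (r e ^ n))
      (cong₂ _*_ (sym (ι-* (u e) (v e))) (sym (^-+ (r e) m n))))
    refl (⟶-* U V))
    where
    lemma : ∀ x p y q → x * p * (y * q) ≡ x * y * (p * q)
    lemma = solve-∀ ℚ-ring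

  grows-raise : ∀ {m u a} → Grows m u a → Grows (suc m) u 0ℚ
  grows-raise {m} {u} {a} (mkGrows U) = mkGrows (⟶-cong
    (λ e → lemma (r e) (ι (u e)) (r e ^ m))
    (*-zeroˡ a) (⟶-* r⟶0 U))
    where
    lemma : ∀ r x p → r * (x * p) ≡ x * (r * p)
    lemma = solve-∀ ℚ-ring

  1-3r : ∀ e → ι e * r e ≡ 1ℚ - ι 3 * r e
  1-3r e = trans (lemma (ι 3) (ι e) (r e)) (cong (_- ι 3 * r e)
    (trans (cong (_* r e) (sym (ι-+ 3 e))) (ιr≡1 e)))
    where
    lemma : ∀ t x r → x * r ≡ (t + x) * r - t * r
    lemma = solve-∀ ℚ-ring

  grows-id : Grows 1 (λ e → e) 1ℚ
  -- Since e = d - 3, the quotient e/d is 1 - 3/d.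
  grows-id = mkGrows (⟶-cong
    (λ e → trans (lemma (ι 3) (r e)) (trans (sym (1-3r e)) (cong (ι e *_) (sym (*-identityʳ (r e))))))
    refl
    (⟶-+ (⟶-const 1ℚ) (⟶-* (⟶-const (- ι 3)) r⟶0)))
    where
    lemma : ∀ t r → 1ℚ + (- t) * r ≡ 1ℚ - t * r
    lemma = solve-∀ ℚ-ring


  -- The quotient as a product of approximate square roots

  inverse-or-0-unique : ∀ p q → p ≢ 0ℚ → p * q ≡ 1ℚ → inverse-or-0 p ≡ q
  inverse-or-0-unique p q p≢0 pq≡1 = begin
    inverse-or-0 p             ≡⟨ *-identityʳ (inverse-or-0 p) ⟨
    inverse-or-0 p * 1ℚ        ≡⟨ cong (inverse-or-0 p *_) pq≡1 ⟨
    inverse-or-0 p * (p * q)   ≡⟨ *-assoc (inverse-or-0 p) p q ⟨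
    inverse-or-0 p * p * q     ≡⟨ cong (_* q) (inverse-or-0-inverse p p≢0) ⟩
    1ℚ * q                     ≡⟨ *-identityˡ q ⟩
    q                          ∎
    where open ≡-Reasoning

  -- If 0 ≤ 1 - ε, then (1 - ε)² ≤ 1 - ε ≤ x²; likewise x² ≤ 1 + ε ≤ (1 + ε)² below. Bounds for x²
  -- near 1 thus pass to x unchanged.
  1-ε≤x²⇒1-ε≤x : ∀ {x ε} → 0ℚ ≤ x → 0ℚ ≤ ε → 1ℚ - ε ≤ x * x → 1ℚ - ε ≤ x
  1-ε≤x²⇒1-ε≤x {x} {ε} 0≤x 0≤ε h with ≤-total 0ℚ (1ℚ - ε)
  ... | inj₂ 1-ε≤0 = ≤-trans 1-ε≤0 0≤x
  ... | inj₁ 0≤1-ε = square-cancel-≤ 0≤x (≤-trans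
    (0≤-⇒≤ (subst (0ℚ ≤_) (lemma ε) (0≤* 0≤1-ε 0≤ε))) h)
    where
    lemma : ∀ ε → (1ℚ - ε) * ε ≡ 1ℚ - ε - (1ℚ - ε) * (1ℚ - ε)
    lemma = solve-∀ ℚ-ring

  x²≤1+ε⇒x≤1+ε : ∀ {x ε} → 0ℚ ≤ ε → x * x ≤ 1ℚ + ε → x ≤ 1ℚ + ε
  x²≤1+ε⇒x≤1+ε {x} {ε} 0≤ε h = square-cancel-≤ (0≤+ 0≤1 0≤ε) (≤-trans h
    (0≤-⇒≤ (subst (0ℚ ≤_) (lemma ε) (0≤* (0≤+ 0≤1 0≤ε) 0≤ε))))
    where
    lemma : ∀ ε → (1ℚ + ε) * ε ≡ (1ℚ + ε) * (1ℚ + ε) - (1ℚ + ε)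
    lemma = solve-∀ ℚ-ring

  -- The main term of the quotient is κ√Q√q, whose square κ²Qq is rational.
  module _ {κ Q q ε : ℚ} (0≤κ : 0ℚ ≤ κ) (0≤Q : 0ℚ ≤ Q) (0≤q : 0ℚ ≤ q) (0≤ε : 0ℚ ≤ ε)
           (L≈1 : ∣ κ * κ * Q * q - 1ℚ ∣ ≤ ε) where

    product-upper : ∀ y t → y * y ≤ Q → t * t ≤ q → κ * y * t ≤ 1ℚ + ε
    product-upper y t y²≤Q t²≤q = x²≤1+ε⇒x≤1+ε 0≤ε (begin
      κ * y * t * (κ * y * t)       ≡⟨ lemma₁ κ y t ⟩
      κ * κ * (y * y * (t * t))     ≤⟨ *-monoˡ-≤-nonNeg (κ * κ) {{nonNegative (0≤* 0≤κ 0≤κ)}}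
                                         (*-mono-≤-nonNeg (square-nonNeg t) 0≤Q y²≤Q t²≤q) ⟩
      κ * κ * (Q * q)               ≡⟨ lemma₂ κ Q q ⟩
      1ℚ + (κ * κ * Q * q - 1ℚ)     ≤⟨ +-monoʳ-≤ 1ℚ (∣p∣≤q⁻ˡ L≈1) ⟩
      1ℚ + ε                        ∎)
      where
      open ≤-Reasoning
      lemma₁ : ∀ κ y t → κ * y * t * (κ * y * t) ≡ κ * κ * (y * y * (t * t))
      lemma₁ = solve-∀ ℚ-ring
      lemma₂ : ∀ κ Q q → κ * κ * (Q * q) ≡ 1ℚ + (κ * κ * Q * q - 1ℚ)
      lemma₂ = solve-∀ ℚ-ring
      lemma₃ : ∀ p → - p * - p ≡ p * p
      lemma₃ = solve-∀ ℚ-ring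
      square-nonNeg : ∀ p → 0ℚ ≤ p * p
      square-nonNeg p with ≤-total 0ℚ p
      ... | inj₁ 0≤p = 0≤* 0≤p 0≤p
      ... | inj₂ p≤0 = subst (0ℚ ≤_) (lemma₃ p) (0≤* (neg-antimono-≤ p≤0) (neg-antimono-≤ p≤0))

    product-lower : ∀ y t → 0ℚ ≤ y → 0ℚ ≤ t → Q ≤ y * y → q ≤ t * t → 1ℚ - ε ≤ κ * y * t
    product-lower y t 0≤y 0≤t Q≤y² q≤t² = 1-ε≤x²⇒1-ε≤x (0≤* (0≤* 0≤κ 0≤y) 0≤t) 0≤ε (begin
      1ℚ - ε                        ≤⟨ +-monoʳ-≤ 1ℚ (neg-antimono-≤ (∣p∣≤q⁻ʳ L≈1)) ⟩
      1ℚ - - (κ * κ * Q * q - 1ℚ)   ≡⟨ lemma₂ κ Q q ⟩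
      κ * κ * (Q * q)               ≤⟨ *-monoˡ-≤-nonNeg (κ * κ) {{nonNegative (0≤* 0≤κ 0≤κ)}}
                                         (*-mono-≤-nonNeg 0≤q (0≤* 0≤y 0≤y) Q≤y² q≤t²) ⟩
      κ * κ * (y * y * (t * t))     ≡⟨ lemma₁ κ y t ⟩
      κ * y * t * (κ * y * t)       ∎)
      where
      open ≤-Reasoning
      lemma₁ : ∀ κ y t → κ * κ * (y * y * (t * t)) ≡ κ * y * t * (κ * y * t)
      lemma₁ = solve-∀ ℚ-ring
      lemma₂ : ∀ κ Q q → 1ℚ - - (κ * κ * Q * q - 1ℚ) ≡ κ * κ * (Q * q)
      lemma₂ = solve-∀ ℚ-ring

  y²≤Q⇒y≤1+Q : ∀ {y Q} → 0ℚ ≤ Q → y * y ≤ Q → y ≤ 1ℚ + Q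
  y²≤Q⇒y≤1+Q {y} {Q} 0≤Q h = x²≤1+ε⇒x≤1+ε 0≤Q (≤-trans h
    (subst (_≤ 1ℚ + Q) (+-identityˡ Q) (+-monoˡ-≤ Q 0≤1)))

  -- A perfect square above both 6 and 10, so that 4 bounds the approximations of √6 and √10.
  16ℚ : ℚ
  16ℚ = + 16 / 1

  √≤4 : ∀ q → 0ℚ ≤ q → q ≤ 16ℚ → ∀ m → seq (√ q) m ≤ ι 4
  √≤4 q 0≤q q≤16 m = square-cancel-≤ (0≤ι 4) (≤-trans (√-lower q 0≤q m) q≤16)

  cubic : ∀ c q → Real.NonZero (Real.fromℕ c Real.* √ q) → ℕ → Real.ℝ
  cubic c q c√q≠0 n = Real.- (Real.inverse (Real.fromℕ c Real.* √ q) c√q≠0 Real.* Real.fromℕ n Real.^ 3)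

  -- The m-th term of the quotient is Aμt + κyt, where y and t are the m-th approximations of √Q and √q.
  module _ (n c : ℕ) (q A B Q ε : ℚ)
           (0≤A : 0ℚ ≤ A) (0≤B : 0ℚ ≤ B) (0≤Q : 0ℚ ≤ Q) (0≤q : 0ℚ ≤ q) (q≤16 : q ≤ 16ℚ) (0<ε : 0ℚ < ε)
           (c√q≠0 : Real.NonZero (Real.fromℕ c Real.* √ q))
           where

    private
      ν = 1 ÷ suc n
      μ = ι c * (ν * (ν * ν))
      κ = B * μ
      x = Real.- Real.fromℚ A Real.- Real.fromℚ B Real.* √ Q
      b = cubic c q c√q≠0 (suc n)

      0≤ν : 0ℚ ≤ ν
      0≤ν = 0≤÷ 1 (suc n)

      0≤μ : 0ℚ ≤ μ
      0≤μ = 0≤* (0≤ι c) (0≤* 0≤ν (0≤* 0≤ν 0≤ν))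

      N₁ = proj₁ (proj₂ (proj₂ c√q≠0))

      y t η : ℕ → ℚ
      y = seq (√ Q)
      t = seq (√ q)
      η m = 1 ÷ suc m

      0≤y : ∀ m → 0ℚ ≤ y m
      0≤y m = 0≤÷ (sqrtNumerator Q m) (suc m)

      0≤t : ∀ m → 0ℚ ≤ t m
      0≤t m = 0≤÷ (sqrtNumerator q m) (suc m)

      ct≢0 : ∀ m → N₁ ℕ.≤ m → ι c * t m ≢ 0ℚ
      ct≢0 m N₁≤m = 0<δ≤∣q∣⇒q≢0 (proj₁ (proj₂ c√q≠0)) (subst (_≤ ∣ ι c * t m ∣)
        (+-identityˡ (proj₁ c√q≠0)) (proj₂ (proj₂ (proj₂ c√q≠0)) m N₁≤m))

      -- The comparison function -n³/(c√q) already contains an inverse, so its reciprocal is simply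
      -- -μ√q with μ = c/n³. For approximations this holds from N₁ on, where the inverted term is
      -- nonzero.
      b*v≡1 : ∀ m → N₁ ℕ.≤ m → seq b m * (- (μ * t m)) ≡ 1ℚ
      b*v≡1 m N₁≤m = begin
        - (inverse-or-0 (ι c * t m) * (ι (suc n) * (ι (suc n) * (ι (suc n) * 1ℚ)))) * - (μ * t m)
          ≡⟨ lemma (inverse-or-0 (ι c * t m)) (ι c) (t m) (ι (suc n)) ν ⟩
        (inverse-or-0 (ι c * t m) * (ι c * t m)) * ((ι (suc n) * ν) * ((ι (suc n) * ν) * (ι (suc n) * ν)))
          ≡⟨ cong₂ (λ x y → x * (y * (y * y))) (inverse-or-0-inverse _ (ct≢0 m N₁≤m)) (ι*÷ 1 n) ⟩
        1ℚ * (1ℚ * (1ℚ * 1ℚ)) ≡⟨⟩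
        1ℚ ∎
        where
        open ≡-Reasoning
        lemma : ∀ i c t n ν → - (i * (n * (n * (n * 1ℚ)))) * - (c * (ν * (ν * ν)) * t)
          ≡ (i * (c * t)) * ((n * ν) * ((n * ν) * (n * ν)))
        lemma = solve-∀ ℚ-ring

      b≢0 : ∀ m → N₁ ℕ.≤ m → seq b m ≢ 0ℚ
      b≢0 m N₁≤m e = contradiction
        (trans (sym (trans (cong (_* - (μ * t m)) e) (*-zeroˡ (- (μ * t m))))) (b*v≡1 m N₁≤m)) λ ()

      quotient : ∀ m → N₁ ℕ.≤ m →
        seq x m * inverse-or-0 (seq b m) - 1ℚ ≡ A * μ * t m + κ * y m * t m - 1ℚ
      quotient m N₁≤m = cong (_- 1ℚ) (trans
        (cong (seq x m *_) (inverse-or-0-unique (seq b m) (- (μ * t m)) (b≢0 m N₁≤m) (b*v≡1 m N₁≤m)))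
        (lemma A B (y m) μ (t m)))
        where
        lemma : ∀ A B y μ t → (- A + - (B * y)) * - (μ * t) ≡ A * μ * t + B * μ * y * t
        lemma = solve-∀ ℚ-ring

    -- From b · (-μt) = 1 and μt ≤ 4μ ≤ K it follows that |b| ≥ 1/K. The summand 1 in K guarantees
    -- that K is positive.
    cubic-nonZero : Real.NonZero b
    cubic-nonZero = δ , 0<δ , N₁ , λ m N₁≤m → *-cancelʳ-≤-pos K {{positive 0<K}} (begin
      (0ℚ + δ) * K                       ≡⟨ cong (_* K) (+-identityˡ δ) ⟩
      δ * K                              ≡⟨ *-comm δ K ⟩
      K * δ                              ≡⟨ *-inverseʳ K ⟩
      ∣ 1ℚ ∣                             ≡⟨ cong ∣_∣ (b*v≡1 m N₁≤m) ⟨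
      ∣ seq b m * - (μ * t m) ∣          ≡⟨ ∣p*q∣≡∣p∣*∣q∣ (seq b m) (- (μ * t m)) ⟩
      ∣ seq b m ∣ * ∣ - (μ * t m) ∣      ≤⟨ *-monoˡ-≤-nonNeg ∣ seq b m ∣ {{∣-∣-nonNeg (seq b m)}} (v≤K m) ⟩
      ∣ seq b m ∣ * K                    ∎)
      where
      open ≤-Reasoning
      K = 1ℚ + μ * ι 4
      0<K : 0ℚ < K
      0<K = <-≤-trans (positive⁻¹ 1ℚ) (subst (_≤ K) (+-identityʳ 1ℚ) (+-monoʳ-≤ 1ℚ (0≤* 0≤μ (0≤ι 4))))
      instance
        K⁺ = positive 0<K
        K≢0 = pos⇒nonZero K
      δ = 1/ K
      0<δ = positive⁻¹ δ {{1/pos⇒pos K}}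
      v≤K : ∀ m → ∣ - (μ * t m) ∣ ≤ K
      v≤K m = begin
        ∣ - (μ * t m) ∣ ≡⟨ ∣-p∣≡∣p∣ (μ * t m) ⟩
        ∣ μ * t m ∣     ≡⟨ 0≤p⇒∣p∣≡p (0≤* 0≤μ (0≤t m)) ⟩
        μ * t m         ≤⟨ *-monoˡ-≤-nonNeg μ {{nonNegative 0≤μ}} (√≤4 q 0≤q q≤16 m) ⟩
        μ * ι 4         ≡⟨ +-identityˡ (μ * ι 4) ⟨
        0ℚ + μ * ι 4    ≤⟨ +-monoˡ-≤ (μ * ι 4) 0≤1 ⟩
        K               ∎

    module _ (L≈1 : ∣ κ * κ * Q * q - 1ℚ ∣ ≤ ε) (Aμ4≤ε : A * μ * ι 4 ≤ ε) where

      private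
        0≤ε = <⇒≤ 0<ε
        0≤κ = 0≤* 0≤B 0≤μ

        -- The bracket bounds y + t + η, by y ≤ 1 + Q, t ≤ 4 and η ≤ 1.
        K = κ * (1ℚ + Q + ι 4 + 1ℚ)

        0≤K : 0ℚ ≤ K
        0≤K = 0≤* 0≤κ (0≤+ (0≤+ (0≤+ 0≤1 0≤Q) (0≤ι 4)) 0≤1)

        small = eventually-small K 0≤K ε 0<ε

        -- The lower estimate applies to the upper approximations y + η and t + η, whereas the
        -- quotient contains y and t. The difference is a bounded multiple of η = 1/(m+1).
        error≤ : ∀ m → proj₁ small ℕ.≤ m →
          κ * (y m + η m) * (t m + η m) ≤ κ * y m * t m + ε
        error≤ m h = begin
          κ * (y m + η m) * (t m + η m)
            ≡⟨ lemma κ (y m) (t m) (η m) ⟩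
          κ * y m * t m + κ * (y m + t m + η m) * η m
            ≤⟨ +-monoʳ-≤ (κ * y m * t m) (≤-trans
                (*-monoʳ-≤-nonNeg (η m) {{nonNegative (0≤÷ 1 (suc m))}}
                  (*-monoˡ-≤-nonNeg κ {{nonNegative 0≤κ}}
                    (+-mono-≤ (+-mono-≤ (y²≤Q⇒y≤1+Q {y m} 0≤Q (√-lower Q 0≤Q m)) (√≤4 q 0≤q q≤16 m)) (1÷≤1 m))))
                (proj₂ small m h)) ⟩
          κ * y m * t m + ε ∎
          where
          open ≤-Reasoning
          lemma : ∀ κ y t η → κ * (y + η) * (t + η) ≡ κ * y * t + κ * (y + t + η) * η
          lemma = solve-∀ ℚ-ring

        upper : ∀ m → A * μ * t m + κ * y m * t m - 1ℚ ≤ ε + ε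
        upper m = begin
          A * μ * t m + κ * y m * t m - 1ℚ
            ≤⟨ +-monoˡ-≤ (- 1ℚ) (+-mono-≤
                (≤-trans (*-monoˡ-≤-nonNeg (A * μ) {{nonNegative (0≤* 0≤A 0≤μ)}} (√≤4 q 0≤q q≤16 m)) Aμ4≤ε)
                (product-upper 0≤κ 0≤Q 0≤q 0≤ε L≈1 (y m) (t m) (√-lower Q 0≤Q m) (√-lower q 0≤q m))) ⟩
          ε + (1ℚ + ε) - 1ℚ
            ≡⟨ lemma ε ⟩
          ε + ε ∎
          where
          open ≤-Reasoning
          lemma : ∀ ε → ε + (1ℚ + ε) - 1ℚ ≡ ε + ε
          lemma = solve-∀ ℚ-ring

        lower : ∀ m → proj₁ small ℕ.≤ m → - (A * μ * t m + κ * y m * t m - 1ℚ) ≤ ε + ε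
        lower m h = 0≤-⇒≤ (subst (0ℚ ≤_) (lemma (A * μ * t m) (κ * y m * t m) ε)
          (0≤+ (0≤* (0≤* 0≤A 0≤μ) (0≤t m)) (≤⇒0≤- (≤-trans
            (product-lower 0≤κ 0≤Q 0≤q 0≤ε L≈1 (y m + η m) (t m + η m)
              (0≤+ (0≤y m) (0≤÷ 1 (suc m))) (0≤+ (0≤t m) (0≤÷ 1 (suc m))) (√-upper Q 0≤Q m) (√-upper q 0≤q m))
            (error≤ m h)))))
          where
          lemma : ∀ S z ε → S + (z + ε - (1ℚ - ε)) ≡ ε + ε - - (S + z - 1ℚ)
          lemma = solve-∀ ℚ-ring

      quotient-close : Real.∣ Real.divide x b cubic-nonZero Real.- Real.fromℕ 1 ∣ Real.< Real.fromℚ (ε + ε + (ε + ε))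
      -- The order on the reals demands a positive rational gap: the distance is at most 2ε, and a
      -- gap of 2ε gives the bound 4ε.
      quotient-close = ε + ε , +-mono-< 0<ε 0<ε , N₁ ℕ.⊔ proj₁ small , λ m h →
        +-monoˡ-≤ (ε + ε) (subst (λ z → ∣ z ∣ ≤ ε + ε)
          (sym (quotient m (ℕ.≤-trans (ℕ.m≤m⊔n N₁ _) h)))
          (∣p∣≤q⁺ (upper m) (lower m (ℕ.≤-trans (ℕ.m≤n⊔m N₁ _) h))))

-- Limits of the ratios and the two parities

module Asymptotics where

  import Defs as Real
  open import Defs using (_÷_; √; x₋; _∼_through_; D)
  open Counting
  open Approximation
  open import Data.Integer.Base using (+_)
  open import Data.Nat.Base as ℕ using (ℕ; zero; suc; s≤s)
  open import Data.Nat.Divisibility using (_∣_; _∤_; m%n≡0⇒n∣m; n∣m⇒m%n≡0)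
  import Data.Nat.DivMod as ℕ
  import Data.Nat.Properties as ℕ
  import Data.Nat.Tactic.RingSolver as ℕ-Solver
  open import Data.Product.Base using (∃; proj₁; proj₂; _,_)
  open import Data.Rational.Base hiding (_÷_)
  open import Data.Rational.Properties
  open import Data.Sum.Base using (inj₁; inj₂)
  open import Relation.Binary.PropositionalEquality
  open import Relation.Nullary using (contradiction)
  open import Relation.Nullary.Decidable using (from-no; from-yes)
  open import Tactic.RingSolver using (solve-∀)

  ÷-÷ : ∀ a d b → b ≢ 0 → a ÷ (suc d ℕ.* b) ≡ (a ÷ b) * (1 ÷ suc d)
  ÷-÷ a d zero    b≢0 = contradiction refl b≢0
  ÷-÷ a d (suc b) _   = *-cancelˡ-ι (b ℕ.+ d ℕ.* suc b) (trans (ι*÷ a (b ℕ.+ d ℕ.* suc b)) (sym (begin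
    ι (suc d ℕ.* suc b) * ((a ÷ suc b) * (1 ÷ suc d))
      ≡⟨ cong (_* ((a ÷ suc b) * (1 ÷ suc d))) (ι-* (suc d) (suc b)) ⟩
    ι (suc d) * ι (suc b) * ((a ÷ suc b) * (1 ÷ suc d))
      ≡⟨ lemma (ι (suc d)) (ι (suc b)) (a ÷ suc b) (1 ÷ suc d) ⟩
    (ι (suc d) * (1 ÷ suc d)) * (ι (suc b) * (a ÷ suc b))
      ≡⟨ cong₂ _*_ (ι*÷ 1 d) (ι*÷ a b) ⟩
    1ℚ * ι a
      ≡⟨ *-identityˡ (ι a) ⟩
    ι a ∎)))
    where
    open ≡-Reasoning
    lemma : ∀ d b x z → d * b * (x * z) ≡ (d * z) * (b * x)
    lemma = solve-∀ ℚ-ring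

  ÷-cross-≢0 : ∀ a b p q → b ≢ 0 → a ℕ.* suc q ≡ p ℕ.* b → a ÷ b ≡ p ÷ suc q
  ÷-cross-≢0 a zero    p q b≢0 _ = contradiction refl b≢0
  ÷-cross-≢0 a (suc b) p q _   e = ÷-cross a b p q e

  -- Throughout, n = 2d + p with d = 3 + e.
  n : ℕ → ℕ → ℕ
  n p e = (3 ℕ.+ e) ℕ.* 2 ℕ.+ p

  ν ρ : ℕ → ℕ → ℚ
  ν p e = 1 ÷ n p e
  ρ p e = ι (3 ℕ.+ e) * ν p e

  -- The factors (d - 1)/d and 2d/(d - 1) in the formula for x₋.
  B M : ℕ → ℚ
  B e = (2 ℕ.+ e) ÷ (3 ℕ.+ e)
  M e = (2 ℕ.* (3 ℕ.+ e)) ÷ (2 ℕ.+ e)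

  μ κ : ℕ → ℕ → ℕ → ℚ
  μ p c e = ι c * (ν p e * (ν p e * ν p e))
  κ p c e = B e * μ p c e

  radicand : (ℕ → ℚ) → (ℕ → ℚ) → ℕ → ℚ
  radicand R₁ R₂ e = R₁ e * R₁ e - M e * R₂ e

  ιnν≡1 : ∀ p e → ι (n p e) * ν p e ≡ 1ℚ
  ιnν≡1 p e = ι*÷ 1 (suc ((2 ℕ.+ e) ℕ.* 2 ℕ.+ p))

  ν≤r : ∀ p e → ν p e ≤ r e
  ν≤r p e = ≤-cancel-ι (suc ((2 ℕ.+ e) ℕ.* 2 ℕ.+ p)) (begin
    ι (n p e) * ν p e         ≡⟨ trans (ιnν≡1 p e) (sym (ιr≡1 e)) ⟩
    ι (3 ℕ.+ e) * r e     ≤⟨ *-monoʳ-≤-nonNeg (r e) {{nonNegative (0≤r e)}} (ι-mono-≤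
                               (ℕ.≤-trans (ℕ.m≤m*n (3 ℕ.+ e) 2) (ℕ.m≤m+n _ p))) ⟩
    ι (n p e) * r e         ∎)
    where open ≤-Reasoning

  ν⟶0 : ∀ p → ν p ⟶ 0ℚ
  ν⟶0 p = ⟶-null (λ e → 0≤÷ 1 (n p e)) (ν≤r p)

  -- As n = 2d + p, the ratio d/n equals 1/2 - p/(2n). Through ρ, powers of 1/n are converted into
  -- powers of 1/d.
  ρ⟶½ : ∀ p → ρ p ⟶ ½
  ρ⟶½ p = ⟶-cong eq (lemma₀ (ι p)) (⟶-+ (⟶-const ½) (⟶-* (⟶-const (- (½ * ι p))) (ν⟶0 p)))
    where
    lemma₀ : ∀ p → ½ + (- (½ * p)) * 0ℚ ≡ ½
    lemma₀ = solve-∀ ℚ-ring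
    lemma : ∀ d p ν → ½ * ((d * (1ℚ + 1ℚ) + p) * ν) + (- (½ * p)) * ν ≡ d * ν
    lemma = solve-∀ ℚ-ring
    ι-n : ∀ e → ι (n p e) ≡ ι (3 ℕ.+ e) * (1ℚ + 1ℚ) + ι p
    ι-n e = trans (ι-+ ((3 ℕ.+ e) ℕ.* 2) p) (cong (_+ ι p) (ι-* (3 ℕ.+ e) 2))
    eq : ∀ e → ½ + (- (½ * ι p)) * ν p e ≡ ρ p e
    eq e = begin
      ½ + (- (½ * ι p)) * ν p e
        ≡⟨ cong (_+ (- (½ * ι p)) * ν p e) (*-identityʳ ½) ⟨
      ½ * 1ℚ + (- (½ * ι p)) * ν p e
        ≡⟨ cong (λ x → ½ * x + (- (½ * ι p)) * ν p e) (trans (sym (ιnν≡1 p e)) (cong (_* ν p e) (ι-n e))) ⟩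
      ½ * ((ι (3 ℕ.+ e) * (1ℚ + 1ℚ) + ι p) * ν p e) + (- (½ * ι p)) * ν p e
        ≡⟨ lemma (ι (3 ℕ.+ e)) (ι p) (ν p e) ⟩
      ρ p e ∎
      where open ≡-Reasoning

  ν≡ρr : ∀ p e → ν p e ≡ ρ p e * r e
  ν≡ρr p e = begin
    ν p e                         ≡⟨ *-identityˡ (ν p e) ⟨
    1ℚ * ν p e                    ≡⟨ cong (_* ν p e) (ιr≡1 e) ⟨
    ι (3 ℕ.+ e) * r e * ν p e     ≡⟨ lemma (ι (3 ℕ.+ e)) (r e) (ν p e) ⟩
    ρ p e * r e                   ∎
    where
    open ≡-Reasoning
    lemma : ∀ d r ν → d * r * ν ≡ d * ν * r
    lemma = solve-∀ ℚ-ring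

  B≡ιr : ∀ e → B e ≡ ι (2 ℕ.+ e) * r e
  B≡ιr e = ÷≡ι* (2 ℕ.+ e) (2 ℕ.+ e)

  B⟶1 : B ⟶ 1ℚ
  B⟶1 = ⟶-cong eq refl (⟶-+ (⟶-const 1ℚ) (⟶-* (⟶-const (- 1ℚ)) r⟶0))
    where
    lemma : ∀ x r → (1ℚ + x) * r + (- 1ℚ) * r ≡ x * r
    lemma = solve-∀ ℚ-ring
    eq : ∀ e → 1ℚ + (- 1ℚ) * r e ≡ B e
    eq e = begin
      1ℚ + (- 1ℚ) * r e
        ≡⟨ cong (_+ (- 1ℚ) * r e) (trans (sym (ιr≡1 e)) (cong (_* r e) (ι-+ 1 (2 ℕ.+ e)))) ⟩
      (1ℚ + ι (2 ℕ.+ e)) * r e + (- 1ℚ) * r e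
        ≡⟨ lemma (ι (2 ℕ.+ e)) (r e) ⟩
      ι (2 ℕ.+ e) * r e
        ≡⟨ B≡ιr e ⟨
      B e ∎
      where open ≡-Reasoning

  -- The square of κ supplies two factors B, one of which cancels the denominator of M exactly.
  BM≡2 : ∀ e → B e * M e ≡ ι 2
  BM≡2 e = begin
    B e * M e                          ≡⟨ cong (_* M e) (B≡ιr e) ⟩
    ι (2 ℕ.+ e) * r e * M e            ≡⟨ lemma₁ (ι (2 ℕ.+ e)) (r e) (M e) ⟩
    ι (2 ℕ.+ e) * M e * r e            ≡⟨ cong (_* r e) (trans (ι*÷ (2 ℕ.* (3 ℕ.+ e)) (suc e)) (ι-* 2 (3 ℕ.+ e))) ⟩
    ι 2 * ι (3 ℕ.+ e) * r e            ≡⟨ *-assoc (ι 2) (ι (3 ℕ.+ e)) (r e) ⟩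
    ι 2 * (ι (3 ℕ.+ e) * r e)          ≡⟨ cong (ι 2 *_) (ιr≡1 e) ⟩
    ι 2 * 1ℚ                           ≡⟨ *-identityʳ (ι 2) ⟩
    ι 2                                ∎
    where
    open ≡-Reasoning
    lemma₁ : ∀ x r M → x * r * M ≡ x * M * r
    lemma₁ = solve-∀ ℚ-ring

  -- This is c²q/64 · (x² - 2y), in the shape produced by the limit rules. Here x and y are the
  -- leading coefficients of the two ratios, and 64 comes from (d/n)⁶.
  L∞ : ℕ → ℚ → ℚ → ℚ → ℚ
  L∞ c q x y = ι c * ι c * q * (½ * ½ * ½ * (½ * ½ * ½)) * (1ℚ * 1ℚ * (x * x) + (- ι 2) * (1ℚ * y))

  module _ (p c : ℕ) (q : ℚ) (R₁ R₂ : ℕ → ℚ) {x y : ℚ}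
           (R₁⟶ : (λ e → R₁ e * r e ^ 3) ⟶ x) (R₂⟶ : (λ e → R₂ e * r e ^ 6) ⟶ y) where

    L⟶ : (λ e → κ p c e * κ p c e * radicand R₁ R₂ e * q) ⟶ L∞ c q x y
    L⟶ = ⟶-cong eq refl (⟶-* (⟶-* (⟶-const (ι c * ι c * q)) (⟶-* ρ³ ρ³))
      (⟶-+ (⟶-* (⟶-* B⟶1 B⟶1) (⟶-* R₁⟶ R₁⟶)) (⟶-* (⟶-const (- ι 2)) (⟶-* B⟶1 R₂⟶))))
      where
      ρ³ = ⟶-* (⟶-* (ρ⟶½ p) (ρ⟶½ p)) (ρ⟶½ p)
      lemma : ∀ c q ρ B M r R S →
        c * c * q * (ρ * ρ * ρ * (ρ * ρ * ρ))
          * (B * B * (R * (r * (r * (r * 1ℚ))) * (R * (r * (r * (r * 1ℚ)))))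
             + (- (B * M)) * (B * (S * (r * (r * (r * (r * (r * (r * 1ℚ)))))))))
        ≡ (B * (c * (ρ * r * (ρ * r * (ρ * r))))) * (B * (c * (ρ * r * (ρ * r * (ρ * r)))))
          * (R * R - M * S) * q
      lemma = solve-∀ ℚ-ring
      eq : ∀ e → ι c * ι c * q * (ρ p e * ρ p e * ρ p e * (ρ p e * ρ p e * ρ p e))
             * (B e * B e * (R₁ e * r e ^ 3 * (R₁ e * r e ^ 3)) + (- ι 2) * (B e * (R₂ e * r e ^ 6)))
           ≡ κ p c e * κ p c e * radicand R₁ R₂ e * q
      eq e = begin
        ι c * ι c * q * (ρ p e * ρ p e * ρ p e * (ρ p e * ρ p e * ρ p e))
          * (B e * B e * (R₁ e * r e ^ 3 * (R₁ e * r e ^ 3)) + (- ι 2) * (B e * (R₂ e * r e ^ 6)))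
          ≡⟨ cong (λ z → ι c * ι c * q * (ρ p e * ρ p e * ρ p e * (ρ p e * ρ p e * ρ p e))
               * (B e * B e * (R₁ e * r e ^ 3 * (R₁ e * r e ^ 3)) + (- z) * (B e * (R₂ e * r e ^ 6)))) (BM≡2 e) ⟨
        ι c * ι c * q * (ρ p e * ρ p e * ρ p e * (ρ p e * ρ p e * ρ p e))
          * (B e * B e * (R₁ e * r e ^ 3 * (R₁ e * r e ^ 3)) + (- (B e * M e)) * (B e * (R₂ e * r e ^ 6)))
          ≡⟨ lemma (ι c) q (ρ p e) (B e) (M e) (r e) (R₁ e) (R₂ e) ⟩
        (B e * (ι c * (ρ p e * r e * (ρ p e * r e * (ρ p e * r e)))))
          * (B e * (ι c * (ρ p e * r e * (ρ p e * r e * (ρ p e * r e))))) * radicand R₁ R₂ e * q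
          ≡⟨ cong (λ z → (B e * (ι c * (z * (z * z)))) * (B e * (ι c * (z * (z * z)))) * radicand R₁ R₂ e * q) (ν≡ρr p e) ⟨
        κ p c e * κ p c e * radicand R₁ R₂ e * q ∎
        where open ≡-Reasoning

    -- R₁/d is, up to sign, the first term of x₋. It is O(d²) while μ is O(1/d³).
    S⟶0 : (λ e → R₁ e * r e * μ p c e * ι 4) ⟶ 0ℚ
    S⟶0 = ⟶-cong eq (*-zeroˡ (x * (½ * ½ * ½) * (ι c * ι 4)))
      (⟶-* r⟶0 (⟶-* (⟶-* R₁⟶ (⟶-* (⟶-* (ρ⟶½ p) (ρ⟶½ p)) (ρ⟶½ p))) (⟶-const (ι c * ι 4))))
      where
      lemma : ∀ r R ρ c f → r * (R * (r * (r * (r * 1ℚ))) * (ρ * ρ * ρ) * (c * f))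
              ≡ R * r * (c * (ρ * r * (ρ * r * (ρ * r)))) * f
      lemma = solve-∀ ℚ-ring
      eq : ∀ e → r e * (R₁ e * r e ^ 3 * (ρ p e * ρ p e * ρ p e) * (ι c * ι 4)) ≡ R₁ e * r e * μ p c e * ι 4
      eq e = trans (lemma (r e) (R₁ e) (ρ p e) (ι c) (ι 4))
        (cong (λ z → R₁ e * r e * (ι c * (z * (z * z))) * ι 4) (sym (ν≡ρr p e)))

  ÷⟶ : ∀ {m u a} k → Grows m u a → (λ e → (u e ÷ suc k) * r e ^ m) ⟶ a * (1 ÷ suc k)
  ÷⟶ {m} {u} k (mkGrows U) = ⟶-cong eq refl (⟶-* U (⟶-const (1 ÷ suc k)))
    where
    lemma : ∀ x p z → x * p * z ≡ x * z * p
    lemma = solve-∀ ℚ-ring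
    eq : ∀ e → ι (u e) * r e ^ m * (1 ÷ suc k) ≡ (u e ÷ suc k) * r e ^ m
    eq e = trans (lemma (ι (u e)) (r e ^ m) (1 ÷ suc k)) (cong (_* r e ^ m) (sym (÷≡ι* (u e) k)))

  -- A negative Q would give κ²Qq ≤ 0, at distance at least 1 from 1. So the nonnegativity of the
  -- radicand comes from the limit and not from an inequality between the numbers D(n,k).
  κ²Qq≈1⇒0≤Q : ∀ {κ Q q} → 0ℚ ≤ q → ∣ κ * κ * Q * q - 1ℚ ∣ ≤ ½ → 0ℚ ≤ κ → 0ℚ ≤ Q
  κ²Qq≈1⇒0≤Q {κ} {Q} {q} 0≤q h 0≤κ with ≤-total 0ℚ Q
  ... | inj₁ 0≤Q = 0≤Q
  ... | inj₂ Q≤0 = contradiction (≤-trans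
    (0≤-⇒≤ (subst (0ℚ ≤_) (lemma κ Q q)
      (0≤* (0≤* (0≤* 0≤κ 0≤κ) 0≤q) (neg-antimono-≤ Q≤0))))
    (∣p∣≤q⁻ʳ h)) (from-no (1ℚ ≤? ½))
    where
    lemma : ∀ κ Q q → κ * κ * q * - Q ≡ - (κ * κ * Q * q - 1ℚ) - 1ℚ
    lemma = solve-∀ ℚ-ring

  -- The argument common to both parities: w₀, w₁, w₂ stand for D(n,d), D(n,d-1), D(n,d-2), whose
  -- ratios are U₁/(c₁+1) and U₂/(c₂+1).
  module _ (p c c₁ c₂ : ℕ) (q : ℚ) (0≤q : 0ℚ ≤ q) (q≤16 : q ≤ 16ℚ)
           (c√q≠0 : Real.NonZero (Real.fromℕ c Real.* √ q))
           {U₁ U₂ : ℕ → ℕ} {u₁ u₂ : ℚ} (U₁-grows : Grows 3 U₁ u₁) (U₂-grows : Grows 6 U₂ u₂)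
           (constant : L∞ c q (u₁ * (1 ÷ suc c₁)) (u₂ * (1 ÷ suc c₂)) ≡ 1ℚ)
           (w₀ w₁ w₂ : ℕ → ℕ) (w₀≢0 : ∀ e → w₀ e ≢ 0)
           (w₁-ratio : ∀ e → w₁ e ℕ.* suc c₁ ≡ U₁ e ℕ.* w₀ e)
           (w₂-ratio : ∀ e → w₂ e ℕ.* suc c₂ ≡ U₂ e ℕ.* w₀ e)
           where

    private
      R₁ R₂ A : ℕ → ℚ
      R₁ e = w₁ e ÷ w₀ e
      R₂ e = w₂ e ÷ w₀ e
      A e = w₁ e ÷ ((3 ℕ.+ e) ℕ.* w₀ e)

      R₁⟶ : (λ e → R₁ e * r e ^ 3) ⟶ u₁ * (1 ÷ suc c₁)
      R₁⟶ = ⟶-cong (λ e → cong (_* r e ^ 3) (sym (÷-cross-≢0 (w₁ e) (w₀ e) (U₁ e) c₁ (w₀≢0 e) (w₁-ratio e))))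
        refl (÷⟶ c₁ U₁-grows)

      R₂⟶ : (λ e → R₂ e * r e ^ 6) ⟶ u₂ * (1 ÷ suc c₂)
      R₂⟶ = ⟶-cong (λ e → cong (_* r e ^ 6) (sym (÷-cross-≢0 (w₂ e) (w₀ e) (U₂ e) c₂ (w₀≢0 e) (w₂-ratio e))))
        refl (÷⟶ c₂ U₂-grows)

      L⟶1 : (λ e → κ p c e * κ p c e * radicand R₁ R₂ e * q) ⟶ 1ℚ
      L⟶1 = ⟶-cong (λ _ → refl) constant (L⟶ p c q R₁ R₂ R₁⟶ R₂⟶)

      A⟶0 : (λ e → A e * μ p c e * ι 4) ⟶ 0ℚ
      A⟶0 = ⟶-cong
        (λ e → cong (λ a → a * μ p c e * ι 4) (sym (÷-÷ (w₁ e) (2 ℕ.+ e) (w₀ e) (w₀≢0 e))))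
        refl (S⟶0 p c q R₁ R₂ R₁⟶ R₂⟶)

      0≤κ : ∀ e → 0ℚ ≤ κ p c e
      0≤κ e = 0≤* (0≤÷ (2 ℕ.+ e) (3 ℕ.+ e)) (0≤* (0≤ι c) (0≤* 0≤ν (0≤* 0≤ν 0≤ν)))
        where 0≤ν = 0≤÷ 1 (n p e)

    x₋-ratio : ∀ ε → 0ℚ < ε → ∃ λ N → ∀ e → N ℕ.≤ e →
      ∃ λ (b≠0 : Real.NonZero (cubic c q c√q≠0 (n p e))) →
      Real.∣ Real.divide (Real.- Real.fromℚ (A e) Real.- Real.fromℚ (B e) Real.* √ (radicand R₁ R₂ e))
        (cubic c q c√q≠0 (n p e)) b≠0 Real.- Real.fromℕ 1 ∣ Real.< Real.fromℚ (ε + ε + (ε + ε))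
    x₋-ratio ε 0<ε = N , λ e N≤e →
      let N₁₂≤e = ℕ.≤-trans (ℕ.m≤m⊔n (proj₁ Lε ℕ.⊔ proj₁ L½) (proj₁ Aε)) N≤e
          0≤Q = κ²Qq≈1⇒0≤Q {κ p c e} 0≤q (proj₂ L½ e (ℕ.≤-trans (ℕ.m≤n⊔m (proj₁ Lε) _) N₁₂≤e)) (0≤κ e)
          A≤ε = ≤-trans (≤-reflexive (sym (+-identityʳ _)))
                  (∣p∣≤q⁻ˡ (proj₂ Aε e (ℕ.≤-trans (ℕ.m≤n⊔m (proj₁ Lε ℕ.⊔ proj₁ L½) _) N≤e)))
          0≤A = 0≤÷ (w₁ e) ((3 ℕ.+ e) ℕ.* w₀ e)
          0≤B = 0≤÷ (2 ℕ.+ e) (3 ℕ.+ e)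
      in
      cubic-nonZero (suc ((2 ℕ.+ e) ℕ.* 2 ℕ.+ p)) c q (A e) (B e) (radicand R₁ R₂ e) ε
        0≤A 0≤B 0≤Q 0≤q q≤16 0<ε c√q≠0 ,
      quotient-close (suc ((2 ℕ.+ e) ℕ.* 2 ℕ.+ p)) c q (A e) (B e) (radicand R₁ R₂ e) ε
        0≤A 0≤B 0≤Q 0≤q q≤16 0<ε c√q≠0
        (proj₂ Lε e (ℕ.≤-trans (ℕ.m≤m⊔n _ (proj₁ L½)) N₁₂≤e)) A≤ε
      where
      Lε = ⟶-eventually L⟶1 ε 0<ε
      -- Whatever ε is, the tolerance ½ secures a nonnegative radicand.
      L½ = ⟶-eventually L⟶1 ½ (positive⁻¹ ½)
      Aε = ⟶-eventually A⟶0 ε 0<ε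
      N = proj₁ Lε ℕ.⊔ proj₁ L½ ℕ.⊔ proj₁ Aε

  grows-+c : ∀ c → Grows 1 (λ e → c ℕ.+ e) 1ℚ
  grows-+c c = grows-+ (grows-raise (grows-const c)) grows-id

  -- For fixed n, one block fewer means an excess over the diagonal that is larger by two.
  n-step : ∀ k p → suc k ℕ.* 2 ℕ.+ p ≡ k ℕ.* 2 ℕ.+ (2 ℕ.+ p)
  n-step = ℕ-Solver.solve-∀

  D₀ : ∀ p e → D (n p e) (3 ℕ.+ e) ≡ G p (3 ℕ.+ e)
  D₀ p e = D≡F (n p e) (3 ℕ.+ e)

  D₁ : ∀ p e → D (n p e) (2 ℕ.+ e) ≡ G (2 ℕ.+ p) (2 ℕ.+ e)
  D₁ p e = trans (D≡F (n p e) (2 ℕ.+ e)) (cong (F (2 ℕ.+ e)) (n-step (2 ℕ.+ e) p))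

  D₂ : ∀ p e → D (n p e) (1 ℕ.+ e) ≡ G (4 ℕ.+ p) (1 ℕ.+ e)
  D₂ p e = trans (D≡F (n p e) (1 ℕ.+ e))
    (cong (F (1 ℕ.+ e)) (trans (n-step (2 ℕ.+ e) p) (n-step (1 ℕ.+ e) (2 ℕ.+ p))))

  oddFactorial≢0 : ∀ m → oddFactorial m ≢ 0
  oddFactorial≢0 (suc m) e with ℕ.m*n≡0⇒m≡0∨n≡0 (suc (m ℕ.* 2)) e
  ... | inj₂ e′ = oddFactorial≢0 m e′

  -- Numerators of the ratios over 18 and 9720, respectively 810 and 204120. For odd n one has 3
  -- D(n,d) = d (2d+1)!!, whence the factor 3 and the cancelled factor d = 3 + e.
  even-U₁ even-U₂ odd-U₁ odd-U₂ : ℕ → ℕ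
  even-U₁ e = (2 ℕ.+ e) ℕ.* (3 ℕ.+ e) ℕ.* (1 ℕ.+ (2 ℕ.+ e) ℕ.* 2)
  even-U₂ e = (1 ℕ.+ e) ℕ.* (2 ℕ.+ e) ℕ.* (3 ℕ.+ e) ℕ.* P₄ e
  odd-U₁ e = 3 ℕ.* ((2 ℕ.+ e) ℕ.* (10 ℕ.* ((2 ℕ.+ e) ℕ.* (2 ℕ.+ e)) ℕ.+ 15 ℕ.* (2 ℕ.+ e) ℕ.+ 2))
  odd-U₂ e = 3 ℕ.* ((1 ℕ.+ e) ℕ.* (2 ℕ.+ e) ℕ.* P₅ e)

  even-U₁-grows : Grows 3 even-U₁ (ι 2)
  even-U₁-grows = grows-* (grows-* (grows-+c 2) (grows-+c 3))
    (grows-+ (grows-raise (grows-const 1)) (grows-* (grows-+c 2) (grows-const 2)))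

  P₄-grows : Grows 3 P₄ (ι 20)
  P₄-grows = grows-+ (grows-* (grows-+ (grows-* (grows-+ (grows-* (grows-const 20) grows-id)
    (grows-raise (grows-const 120))) grows-id)
    (grows-raise (grows-raise (grows-const 211)))) grows-id)
    (grows-raise (grows-raise (grows-raise (grows-const 108))))

  even-U₂-grows : Grows 6 even-U₂ (ι 20)
  even-U₂-grows = grows-* (grows-* (grows-* (grows-+c 1) (grows-+c 2)) (grows-+c 3)) P₄-grows

  odd-U₁-grows : Grows 3 odd-U₁ (ι 30)
  odd-U₁-grows = grows-* (grows-const 3) (grows-* (grows-+c 2) (grows-+ (grows-+
    (grows-* (grows-const 10) (grows-* (grows-+c 2) (grows-+c 2)))
    (grows-raise (grows-* (grows-const 15) (grows-+c 2))))
    (grows-raise (grows-raise (grows-const 2)))))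

  P₅-grows : Grows 4 P₅ (ι 28)
  P₅-grows = grows-+ (grows-* (grows-+ (grows-* (grows-+ (grows-* (grows-+ (grows-* (grows-const 28) grows-id)
    (grows-raise (grows-const 252))) grows-id)
    (grows-raise (grows-raise (grows-const 749)))) grows-id)
    (grows-raise (grows-raise (grows-raise (grows-const 861))))) grows-id)
    (grows-raise (grows-raise (grows-raise (grows-raise (grows-const 324)))))

  odd-U₂-grows : Grows 6 odd-U₂ (ι 84)
  odd-U₂-grows = grows-* (grows-const 3) (grows-* (grows-* (grows-+c 1) (grows-+c 2)) P₅-grows)

  even-ratio₁ : ∀ e → D (n 0 e) (2 ℕ.+ e) ℕ.* 18 ≡ even-U₁ e ℕ.* D (n 0 e) (3 ℕ.+ e)
  even-ratio₁ e = begin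
    D (n 0 e) (2 ℕ.+ e) ℕ.* 18                    ≡⟨ cong (ℕ._* 18) (D₁ 0 e) ⟩
    G 2 (2 ℕ.+ e) ℕ.* 18                          ≡⟨ ℕ.*-comm (G 2 (2 ℕ.+ e)) 18 ⟩
    18 ℕ.* G 2 (2 ℕ.+ e)                          ≡⟨ G2 (2 ℕ.+ e) ⟩
    even-U₁ e ℕ.* oddFactorial (3 ℕ.+ e)          ≡⟨ cong (even-U₁ e ℕ.*_) (trans (D₀ 0 e) (G0 (3 ℕ.+ e))) ⟨
    even-U₁ e ℕ.* D (n 0 e) (3 ℕ.+ e)             ∎
    where open ≡-Reasoning

  even-ratio₂ : ∀ e → D (n 0 e) (1 ℕ.+ e) ℕ.* 9720 ≡ even-U₂ e ℕ.* D (n 0 e) (3 ℕ.+ e)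
  even-ratio₂ e = begin
    D (n 0 e) (1 ℕ.+ e) ℕ.* 9720                  ≡⟨ cong (ℕ._* 9720) (D₂ 0 e) ⟩
    G 4 (1 ℕ.+ e) ℕ.* 9720                        ≡⟨ ℕ.*-comm (G 4 (1 ℕ.+ e)) 9720 ⟩
    9720 ℕ.* G 4 (1 ℕ.+ e)                        ≡⟨ G4 e ⟩
    even-U₂ e ℕ.* oddFactorial (3 ℕ.+ e)          ≡⟨ cong (even-U₂ e ℕ.*_) (trans (D₀ 0 e) (G0 (3 ℕ.+ e))) ⟨
    even-U₂ e ℕ.* D (n 0 e) (3 ℕ.+ e)             ∎
    where open ≡-Reasoning

  odd-D₀ : ∀ e → 3 ℕ.* D (n 1 e) (3 ℕ.+ e) ≡ (3 ℕ.+ e) ℕ.* oddFactorial (4 ℕ.+ e)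
  odd-D₀ e = trans (cong (3 ℕ.*_) (D₀ 1 e)) (G1 (3 ℕ.+ e))

  odd-ratio₁ : ∀ e → D (n 1 e) (2 ℕ.+ e) ℕ.* 810 ≡ odd-U₁ e ℕ.* D (n 1 e) (3 ℕ.+ e)
  odd-ratio₁ e = begin
    D (n 1 e) (2 ℕ.+ e) ℕ.* 810                   ≡⟨ cong (ℕ._* 810) (D₁ 1 e) ⟩
    G 3 (2 ℕ.+ e) ℕ.* 810                         ≡⟨ ℕ.*-comm (G 3 (2 ℕ.+ e)) 810 ⟩
    810 ℕ.* G 3 (2 ℕ.+ e)                         ≡⟨ G3 (2 ℕ.+ e) ⟩
    (2 ℕ.+ e) ℕ.* (3 ℕ.+ e) ℕ.* h ℕ.* oddFactorial (4 ℕ.+ e)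
      ≡⟨ lemma₁ (2 ℕ.+ e) (3 ℕ.+ e) h (oddFactorial (4 ℕ.+ e)) ⟩
    (2 ℕ.+ e) ℕ.* h ℕ.* ((3 ℕ.+ e) ℕ.* oddFactorial (4 ℕ.+ e))
      ≡⟨ cong ((2 ℕ.+ e) ℕ.* h ℕ.*_) (odd-D₀ e) ⟨
    (2 ℕ.+ e) ℕ.* h ℕ.* (3 ℕ.* D (n 1 e) (3 ℕ.+ e))
      ≡⟨ lemma₂ (2 ℕ.+ e) h (D (n 1 e) (3 ℕ.+ e)) ⟩
    odd-U₁ e ℕ.* D (n 1 e) (3 ℕ.+ e)              ∎
    where
    open ≡-Reasoning
    h = 10 ℕ.* ((2 ℕ.+ e) ℕ.* (2 ℕ.+ e)) ℕ.+ 15 ℕ.* (2 ℕ.+ e) ℕ.+ 2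
    lemma₁ : ∀ a b h x → a ℕ.* b ℕ.* h ℕ.* x ≡ a ℕ.* h ℕ.* (b ℕ.* x)
    lemma₁ = ℕ-Solver.solve-∀
    lemma₂ : ∀ a h x → a ℕ.* h ℕ.* (3 ℕ.* x) ≡ 3 ℕ.* (a ℕ.* h) ℕ.* x
    lemma₂ = ℕ-Solver.solve-∀

  odd-ratio₂ : ∀ e → D (n 1 e) (1 ℕ.+ e) ℕ.* 204120 ≡ odd-U₂ e ℕ.* D (n 1 e) (3 ℕ.+ e)
  odd-ratio₂ e = begin
    D (n 1 e) (1 ℕ.+ e) ℕ.* 204120                ≡⟨ cong (ℕ._* 204120) (D₂ 1 e) ⟩
    G 5 (1 ℕ.+ e) ℕ.* 204120                      ≡⟨ ℕ.*-comm (G 5 (1 ℕ.+ e)) 204120 ⟩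
    204120 ℕ.* G 5 (1 ℕ.+ e)                      ≡⟨ G5 e ⟩
    (1 ℕ.+ e) ℕ.* (2 ℕ.+ e) ℕ.* (3 ℕ.+ e) ℕ.* P₅ e ℕ.* oddFactorial (4 ℕ.+ e)
      ≡⟨ lemma₁ (1 ℕ.+ e) (2 ℕ.+ e) (3 ℕ.+ e) (P₅ e) (oddFactorial (4 ℕ.+ e)) ⟩
    (1 ℕ.+ e) ℕ.* (2 ℕ.+ e) ℕ.* P₅ e ℕ.* ((3 ℕ.+ e) ℕ.* oddFactorial (4 ℕ.+ e))
      ≡⟨ cong ((1 ℕ.+ e) ℕ.* (2 ℕ.+ e) ℕ.* P₅ e ℕ.*_) (odd-D₀ e) ⟨
    (1 ℕ.+ e) ℕ.* (2 ℕ.+ e) ℕ.* P₅ e ℕ.* (3 ℕ.* D (n 1 e) (3 ℕ.+ e))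
      ≡⟨ lemma₂ (1 ℕ.+ e) (2 ℕ.+ e) (P₅ e) (D (n 1 e) (3 ℕ.+ e)) ⟩
    odd-U₂ e ℕ.* D (n 1 e) (3 ℕ.+ e)              ∎
    where
    open ≡-Reasoning
    lemma₁ : ∀ a b c h x → a ℕ.* b ℕ.* c ℕ.* h ℕ.* x ≡ a ℕ.* b ℕ.* h ℕ.* (c ℕ.* x)
    lemma₁ = ℕ-Solver.solve-∀
    lemma₂ : ∀ a b h x → a ℕ.* b ℕ.* h ℕ.* (3 ℕ.* x) ≡ 3 ℕ.* (a ℕ.* b ℕ.* h) ℕ.* x
    lemma₂ = ℕ-Solver.solve-∀

  even-D₀≢0 : ∀ e → D (n 0 e) (3 ℕ.+ e) ≢ 0
  even-D₀≢0 e D≡0 = oddFactorial≢0 (3 ℕ.+ e) (trans (sym (trans (D₀ 0 e) (G0 (3 ℕ.+ e)))) D≡0)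

  odd-D₀≢0 : ∀ e → D (n 1 e) (3 ℕ.+ e) ≢ 0
  odd-D₀≢0 e D≡0 with ℕ.m*n≡0⇒m≡0∨n≡0 (3 ℕ.+ e) (trans (sym (odd-D₀ e)) (cong (3 ℕ.*_) D≡0))
  ... | inj₂ e′ = oddFactorial≢0 (4 ℕ.+ e) e′

  -- The half is made an independent argument so that the equations for n and for d can be
  -- substituted separately.
  x₋-with-half : ℕ → ℕ → Real.ℝ
  x₋-with-half n d =
    Real.- Real.fromℚ (D n (d ℕ.∸ 1) ÷ (d ℕ.* D n d))
    Real.- Real.fromℚ ((d ℕ.∸ 1) ÷ d)
      Real.* √ ((D n (d ℕ.∸ 1) ÷ D n d) * (D n (d ℕ.∸ 1) ÷ D n d)
           - ((2 ℕ.* d) ÷ (d ℕ.∸ 1)) * (D n (d ℕ.∸ 2) ÷ D n d))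

  module _ (p : ℕ) (P : ℕ → Set) (P⇒%2≡p : ∀ n → P n → n ℕ.% 2 ≡ p) where

    through : ∀ (b : ℕ → Real.ℝ) →
      (∀ ε → 0ℚ < ε → ∃ λ N → ∀ e → N ℕ.≤ e → ∃ λ (b≠0 : Real.NonZero (b (n p e))) →
        Real.∣ Real.divide (x₋-with-half (n p e) (3 ℕ.+ e)) (b (n p e)) b≠0 Real.- Real.fromℕ 1 ∣
          Real.< Real.fromℚ (ε + ε + (ε + ε))) →
      x₋ ∼ b through P
    -- From n ≥ 2(3 + N) follows d ≥ 3 + N, that is e ≥ N.
    through b h ε 0<ε = (3 ℕ.+ N) ℕ.* 2 , λ m N≤m Pm →
      let d = m ℕ./ 2
          3+N≤d : 3 ℕ.+ N ℕ.≤ d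
          3+N≤d = ℕ.≤-trans (ℕ.≤-reflexive (sym (ℕ.m*n/n≡m (3 ℕ.+ N) 2))) (ℕ./-monoˡ-≤ 2 N≤m)
          e = d ℕ.∸ 3
          3+e≡d : 3 ℕ.+ e ≡ d
          3+e≡d = ℕ.m+[n∸m]≡n (ℕ.≤-trans (ℕ.m≤m+n 3 N) 3+N≤d)
          n≡m : n p e ≡ m
          n≡m = trans (cong₂ (λ a c → a ℕ.* 2 ℕ.+ c) 3+e≡d (sym (P⇒%2≡p m Pm)))
            (trans (ℕ.+-comm (d ℕ.* 2) (m ℕ.% 2)) (sym (ℕ.m≡m%n+[m/n]*n m 2)))
      in subst₂ (λ n d → ∃ λ (b≠0 : Real.NonZero (b n)) →
           Real.∣ Real.divide (x₋-with-half n d) (b n) b≠0 Real.- Real.fromℕ 1 ∣ Real.< Real.fromℚ ε)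
         n≡m 3+e≡d
         (subst (λ ε → ∃ λ (b≠0 : Real.NonZero (b (n p e))) →
           Real.∣ Real.divide (x₋-with-half (n p e) (3 ℕ.+ e)) (b (n p e)) b≠0 Real.- Real.fromℕ 1 ∣ Real.< Real.fromℚ ε)
           (quarters ε) (proj₂ H e (ℕ.+-cancelˡ-≤ 3 N e (ℕ.≤-trans 3+N≤d (ℕ.≤-reflexive (sym 3+e≡d))))))
      where
      -- A quarter of ε, because the estimate carries 4ε.
      H = h (½ * (½ * ε)) (half (half 0<ε))
        where
        half : ∀ {ε} → 0ℚ < ε → 0ℚ < ½ * ε
        half {ε} 0<ε = positive⁻¹ (½ * ε) {{pos*pos⇒pos ½ ε {{positive 0<ε}}}}
      N = proj₁ H
      quarters : ∀ ε → ½ * (½ * ε) + ½ * (½ * ε) + (½ * (½ * ε) + ½ * (½ * ε)) ≡ ε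
      quarters = solve-∀ ℚ-ring

  odd⇒%2≡1 : ∀ n → 2 ∤ n → n ℕ.% 2 ≡ 1
  odd⇒%2≡1 n 2∤n with n ℕ.% 2 in eq | ℕ.m%n<n n 2
  ... | 0 | _ = contradiction (m%n≡0⇒n∣m n 2 eq) 2∤n
  ... | 1 | _ = refl
  ... | suc (suc _) | s≤s (s≤s ())

  x₋-even : x₋ ∼ cubic 36 (+ 6 / 1) Real.36√6≠0 through (2 ∣_)
  x₋-even = through 0 (2 ∣_) (λ n → n∣m⇒m%n≡0 n 2) (cubic 36 (+ 6 / 1) Real.36√6≠0)
    -- 17 and 9719 are the predecessors of the denominators 18 and 9720. The `refl` for the limit
    -- value checks 36² · 6/64 · (1/81 - 2/486) = 1.
    (x₋-ratio 0 36 17 9719 (+ 6 / 1) (0≤ι 6) (from-yes (+ 6 / 1 ≤? 16ℚ)) Real.36√6≠0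
      even-U₁-grows even-U₂-grows refl
      (λ e → D (n 0 e) (3 ℕ.+ e)) (λ e → D (n 0 e) (2 ℕ.+ e)) (λ e → D (n 0 e) (1 ℕ.+ e))
      even-D₀≢0 even-ratio₁ even-ratio₂)

  x₋-odd : x₋ ∼ cubic 108 (+ 10 / 1) Real.108√10≠0 through (2 ∤_)
  x₋-odd = through 1 (2 ∤_) odd⇒%2≡1 (cubic 108 (+ 10 / 1) Real.108√10≠0)
    -- Likewise for the denominators 810 and 204120, with 108² · 10/64 · (1/729 - 2/2430) = 1.
    (x₋-ratio 1 108 809 204119 (+ 10 / 1) (0≤ι 10) (from-yes (+ 10 / 1 ≤? 16ℚ)) Real.108√10≠0
      odd-U₁-grows odd-U₂-grows refl
      (λ e → D (n 1 e) (3 ℕ.+ e)) (λ e → D (n 1 e) (2 ℕ.+ e)) (λ e → D (n 1 e) (1 ℕ.+ e))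
      odd-D₀≢0 odd-ratio₁ odd-ratio₂)

open import Defs
open import Data.Integer.Base using (+_)
open import Data.Nat.Divisibility using (_∣_; _∤_)
open import Data.Product.Base using (_×_; _,_)
open import Data.Rational.Base using (_/_)

mainTheorem5 : (x₋ ∼ (λ n → - (inverse (fromℕ 36 * √ (+ 6 / 1)) 36√6≠0 * fromℕ n ^ 3)) through (λ n → 2 ∣ n))
    × (x₋ ∼ (λ n → - (inverse (fromℕ 108 * √ (+ 10 / 1)) 108√10≠0 * fromℕ n ^ 3)) through (λ n → 2 ∤ n))
mainTheorem5 = Asymptotics.x₋-even , Asymptotics.x₋-odd
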